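{- Let $n\ge1$, let $\sigma\in\mathfrak{S}_n$, and let $\Psi=(\psi_{FV}^0)^{ -1}\circ\psi\circ\psi_{FV}:\mathfrak{S}_n\to\mathfrak{S}_n$. Then $\sigma$ and $\Psi(\sigma)$ belong to the same co-sylvester class, i.e. $\mathrm{BST}(\sigma)=\mathrm{BST}(\Psi(\sigma))$.
   Context: $\mathfrak{S}_n$ is the set of permutations $\sigma=\sigma_1\cdots\sigma_n$ of $\{1,\dots,n\}$. For a value $k$, $\mathrm{tot}_k(\sigma)$ is the number of pairs $(i,j)$ with $i+1<j$, $\sigma_j=k$ and $\sigma_{i+1}<\sigma_j<\sigma_i$. Weighted Dyck paths. A Dyck path of size $n$ is a sequence $D=D_1\cdots D_{2n}$ of $n$ up steps $/$ and $n$ down steps $\backslash$ never going below the horizontal axis. A weighted Dyck path of size $n$ is a pair $(D,w)$ with $D$ a Dyck path of size $n$ and $w=(w_1,\dots,w_n)$ a vector of nonnegative integers with $w_i\le (h_i-1)/2$ for all $i$, where $h_i$ is the height of the starting point of step $D_{2i}$. The bijection $\psi_{FV}$ (permutations of size $n$ to weighted Dyck paths of size $n$): with the convention $\sigma_0=0$, $\sigma_{n+1}=n+1$, $\psi_{FV}(\sigma)=(D,w)$ where for each $j\in\{1,\dots,n\}$ and $k=\sigma_j$: $D_{2k-1}=/$ if $\sigma_j<\sigma_{j+1}$ and $D_{2k-1}=\backslash$ otherwise; $D_{2k}=\backslash$ if $\sigma_{j-1}<\sigma_j$ and $D_{2k}=/$ otherwise; $w_k=\mathrm{tot}_k(\sigma)$.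 The bijection $\psi_{FV}^0$ (permutations of size $n$ to weighted Dyck paths of size $n$): with the convention $\sigma_0=\sigma_{n+1}=0$, apply the same rules to the values $1,\dots,n-1$ only, then add an up step at the beginning and a down step at the end of the path, and a $0$ at the end of the weight. Explicitly, $\psi^0_{FV}(\sigma)=(D,w)$ with $D_1=/$, $D_{2n}=\backslash$, $w_n=0$, and for each $k=\sigma_j\in\{1,\dots,n-1\}$: $D_{2k}=/$ if $\sigma_j<\sigma_{j+1}$ and $\backslash$ otherwise; $D_{2k+1}=\backslash$ if $\sigma_{j-1}<\sigma_j$ and $/$ otherwise; $w_k=\mathrm{tot}_k(\sigma)$. The involution $\psi$ on weighted Dyck paths of size $n$: for each $i\in\{1,\dots,n-1\}$, if the steps at positions $2i,2i+1$ are $/\backslash$ they are replaced by $\backslash/$ and vice versa (otherwise they are unchanged); the weight is unchanged. Binary search trees. A binary search tree is a labeled binary tree such that for each node all values in its left (resp. right) subtree are smaller (resp. greater) than the value at the node. $\mathrm{BST}(\sigma)$ is the binary search tree built recursively: start with $I=\{1,\dots,n\}$; the root for the interval $I$ is the first (leftmost) value of $\sigma$ lying in $I$, say $k$; its left subtree is obtained by applying the procedure to the elements of $I$ smaller than $k$ and its right subtree by applying it to those greater than $k$ (an empty interval gives an empty tree). Two permutations belong to the same co-sylvester class if they have the same $\mathrm{BST}$. -}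

module Defs where

open import Data.Bool using (Bool; true; false; if_then_else_; _∧_)
open import Data.Empty using (⊥; ⊥-elim)
open import Data.Fin as Fin using (Fin; toℕ; fromℕ; fromℕ<; inject₁; cast)
open import Data.Fin.Permutation using
  (Permutation′; _⟨$⟩ʳ_; _⟨$⟩ˡ_; _≈_; _∘ₚ_; cast-id; inverseˡ; inverseʳ)
open import Data.Fin.Properties using
  (toℕ<n; toℕ-inject₁; toℕ-fromℕ; toℕ-fromℕ<; fromℕ<-toℕ; cast-is-id; cast-involutive; toℕ-injective)
open import Data.List using
  ( List; []; _∷_; _++_; take; drop; filter; find; concatMap; tabulate; applyUpTo; replicate
  ; length; lookup)
open import Data.List.Properties using
  ( ++-identityʳ; tabulate-cong; tabulate-lookup; length-tabulate; lookup-tabulate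
  ; ∷-injectiveˡ; ∷-injectiveʳ; concatMap-cong)
import Data.List.Relation.Binary.Permutation.Homogeneous as HomogeneousPermutation
open import Data.List.Relation.Binary.Permutation.Propositional using
  (_↭_; ↭-refl; ↭-sym; ↭-trans; ↭-prep; ↭-swap; ↭-reflexive; ↭⇒↭ₛ)
import Data.List.Relation.Binary.Permutation.Propositional.Properties as ↭
import Data.List.Relation.Binary.Permutation.Setoid.Properties as ↭ₛ
open import Data.List.Relation.Unary.All using (All; []; _∷_)
import Data.List.Relation.Unary.All.Properties as All
open import Data.Maybe using (just; nothing)
open import Data.Nat using
  ( ℕ; zero; suc; pred; _+_; _*_; _∸_; _/_; _≤_; _<_; z≤n; s≤s; _<?_; _≤?_)
open import Data.Nat.DivMod using (m*n/n≡m)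
open import Data.Nat.Properties using
  ( ≤-refl; ≤-reflexive; ≤-trans; <-trans; <-irrefl; <-asym; <⇒≤; ≤-<-trans; <-≤-trans; ≤∧≢⇒<
  ; ≤-pred; n≤1+n; n<1+n; m≤m+n; m≤n+m; m<n⇒m<1+n; suc-injective; +-suc; +-comm; +-assoc
  ; +-identityʳ)
open import Data.Product using (∃; _×_; _,_; proj₁; proj₂)
open import Data.Vec as Vec using (Vec; []; _∷_)
import Data.Vec.Properties as Vec
open import Function using (_∘_; Inverse)
open import Relation.Binary using (Setoid)
import Relation.Binary.Construct.On as On
open import Relation.Binary.PropositionalEquality using
  (_≡_; _≢_; refl; sym; trans; cong; cong₂; subst; setoid)
open import Relation.Nullary.Decidable using (does; yes; no; _×-dec_; dec-false)
open import Relation.Unary using (Decidable)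

-- The element k of Fin n stands for the value (or position) toℕ k + 1 of {1,…,n}.
⟦_⟧ : ∀ {n} → Fin n → ℕ
⟦ k ⟧ = suc (toℕ k)

-- letter e σ i = σᵢ, with the conventions σ₀ = 0 and σₙ₊₁ = e.
letter : ∀ {n} → ℕ → Permutation′ n → ℕ → ℕ
letter e σ zero = 0
letter {n} e σ (suc i) with i <? n
... | yes i<n = ⟦ σ ⟨$⟩ʳ fromℕ< i<n ⟧
... | no _    = e

word : ∀ {n} → Permutation′ n → List ℕ
word σ = tabulate (λ i → ⟦ σ ⟨$⟩ʳ i ⟧)

pos : ∀ {n} → Permutation′ n → Fin n → ℕ
pos σ k = ⟦ σ ⟨$⟩ˡ k ⟧

-- The number of pairs (i , j) with i + 1 < j, σⱼ = k, σᵢ₊₁ < σⱼ < σᵢ; here j is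
-- necessarily the position of k, so it suffices to count the i in {1,…,n}.  The
-- convention for σₙ₊₁ is irrelevant, since i + 1 < j.
tot : ∀ {n} → Permutation′ n → Fin n → ℕ
tot {n} σ k = length (filter
  (λ i → (suc i <? pos σ k) ×-dec ((letter 0 σ (suc i) <? ⟦ k ⟧) ×-dec (⟦ k ⟧ <? letter 0 σ i)))
  (applyUpTo suc n))

data Step : Set where
  up down : Step

ups : List Step → ℕ
ups []         = 0
ups (up   ∷ D) = suc (ups D)
ups (down ∷ D) = ups D

downs : List Step → ℕ
downs []         = 0
downs (up   ∷ D) = downs D
downs (down ∷ D) = suc (downs D)

record IsDyckPath (n : ℕ) (D : List Step) : Set where
  field
    n-ups       : ups D ≡ n
    n-downs     : downs D ≡ n
    never-below : ∀ i → downs (take i D) ≤ ups (take i D)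

-- The height reached after i steps (truncated subtraction is exact on Dyck paths).
height : List Step → ℕ → ℕ
height D i = ups (take i D) ∸ downs (take i D)

-- For i = toℕ k + 1, the starting point of step D₂ᵢ is reached after 2i - 1 = 2 (toℕ k) + 1
-- steps; its height is odd, so ∸ and / below are exact.
record WeightedDyckPath (n : ℕ) : Set where
  constructor mkWDP
  field
    path         : List Step
    weight       : Vec ℕ n
    isDyckPath   : IsDyckPath n path
    weight-bound : ∀ (k : Fin n) →
                   Vec.lookup weight k ≤ (height path (suc (2 * toℕ k)) ∸ 1) / 2

open WeightedDyckPath public

right-step left-step : ∀ {n} → ℕ → Permutation′ n → Fin n → Step
right-step e σ k = if does (⟦ k ⟧ <? letter e σ (suc (pos σ k))) then up else down
left-step  e σ k = if does (letter e σ (pos σ k ∸ 1) <? ⟦ k ⟧) then down else up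

-- The steps attached to the value k: D₂ₖ₋₁D₂ₖ for ψFV (e = n + 1), D₂ₖD₂ₖ₊₁ for ψ⁰FV (e = 0).
two-steps : ∀ {n} → ℕ → Permutation′ n → Fin n → List Step
two-steps e σ k = right-step e σ k ∷ left-step e σ k ∷ []

FV-path : ∀ {n} → Permutation′ n → List Step
FV-path {n} σ = concatMap (two-steps (suc n) σ) (tabulate (λ k → k))

FV-weight : ∀ {n} → Permutation′ n → Vec ℕ n
FV-weight σ = Vec.tabulate (tot σ)

-- Here n = m + 1 ≥ 1, and inject₁ embeds {1,…,n - 1} into {1,…,n}.
FV⁰-path : ∀ {m} → Permutation′ (suc m) → List Step
FV⁰-path σ = up ∷ concatMap (two-steps 0 σ) (tabulate inject₁) ++ down ∷ []

FV⁰-weight : ∀ {m} → Permutation′ (suc m) → Vec ℕ (suc m)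
FV⁰-weight σ = Vec.tabulate (λ k → tot σ (inject₁ k)) Vec.∷ʳ 0

-- swap-pairs acts on D₂D₃⋯D₂ₙ: it replaces /\ by \/ and vice versa in D₂ᵢD₂ᵢ₊₁.
swap-pairs : List Step → List Step
swap-pairs (up   ∷ down ∷ D) = down ∷ up   ∷ swap-pairs D
swap-pairs (down ∷ up   ∷ D) = up   ∷ down ∷ swap-pairs D
swap-pairs (up   ∷ up   ∷ D) = up   ∷ up   ∷ swap-pairs D
swap-pairs (down ∷ down ∷ D) = down ∷ down ∷ swap-pairs D
swap-pairs (s ∷ [])          = s ∷ []
swap-pairs []                = []

ψ-path : List Step → List Step
ψ-path []      = []
ψ-path (s ∷ D) = s ∷ swap-pairs D

data Tree : Set where
  leaf : Tree
  node : Tree → ℕ → Tree → Tree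

-- bst f lo hi W is the tree of the interval {lo,…,hi}.  The interval shrinks at every
-- recursive call, so any f at least its size gives the same tree.
bst : ℕ → ℕ → ℕ → List ℕ → Tree
bst zero    lo hi W = leaf
bst (suc f) lo hi W with find (λ v → (lo ≤? v) ×-dec (v ≤? hi)) W
... | nothing = leaf
... | just k  = node (bst f lo (k ∸ 1) W) k (bst f (suc k) hi W)

BST : ∀ {n} → Permutation′ n → Tree
BST {n} σ = bst n 1 n (word σ)

-- EvenFrom h D w (resp. OddFrom h D w): D, started at height 2h (resp. 2h + 1), never
-- goes below the axis, ends at height 0, and w is an admissible weight for it.
mutual
  data EvenFrom : ∀ {n} → ℕ → List Step → Vec ℕ n → Set where
    end  : EvenFrom 0 [] []
    up   : ∀ {n h D} {w : Vec ℕ n} → OddFrom h D w → EvenFrom h (up ∷ D) w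
    down : ∀ {n h D} {w : Vec ℕ n} → OddFrom h D w → EvenFrom (suc h) (down ∷ D) w

  data OddFrom : ∀ {n} → ℕ → List Step → Vec ℕ n → Set where
    up   : ∀ {n h D t} {w : Vec ℕ n} → t ≤ h → EvenFrom (suc h) D w → OddFrom h (up ∷ D) (t ∷ w)
    down : ∀ {n h D t} {w : Vec ℕ n} → t ≤ h → EvenFrom h D w → OddFrom h (down ∷ D) (t ∷ w)

record DyckFrom (H m : ℕ) (D : List Step) : Set where
  constructor mkDF
  field
    len    : length D ≡ m
    level  : H + ups D ≡ downs D
    above  : ∀ i → downs (take i D) ≤ H + ups (take i D)
open DyckFrom

heightFrom : ℕ → List Step → ℕ → ℕ
heightFrom H D i = (H + ups (take i D)) ∸ downs (take i D)

up-from : ∀ {H m D} → DyckFrom (suc H) m D → DyckFrom H (suc m) (up ∷ D)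
up-from {H} {m} {D} d = mkDF (cong suc (len d)) (trans (+-suc H _) (level d)) λ
  { zero    → z≤n
  ; (suc i) → subst (downs (take i D) ≤_) (sym (+-suc H _)) (above d i) }

up-to : ∀ {H m D} → DyckFrom H (suc m) (up ∷ D) → DyckFrom (suc H) m D
up-to {H} {m} {D} d = mkDF (suc-injective (len d)) (trans (sym (+-suc H _)) (level d))
  λ i → subst (downs (take i D) ≤_) (+-suc H _) (above d (suc i))

down-from : ∀ {H m D} → DyckFrom H m D → DyckFrom (suc H) (suc m) (down ∷ D)
down-from d = mkDF (cong suc (len d)) (cong suc (level d)) λ
  { zero    → z≤n
  ; (suc i) → s≤s (above d i) }

down-to : ∀ {H m D} → DyckFrom (suc H) (suc m) (down ∷ D) → DyckFrom H m D
down-to d = mkDF (suc-injective (len d)) (suc-injective (level d)) λ i → ≤-pred (above d (suc i))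

heightFrom-up : ∀ H D i → heightFrom H (up ∷ D) (suc i) ≡ heightFrom (suc H) D i
heightFrom-up H D i = cong (_∸ downs (take i D)) (+-suc H _)

heightFrom-zero : ∀ H D → heightFrom H D 0 ≡ H
heightFrom-zero H D = +-identityʳ H

WeightFrom : ∀ {n} → ℕ → ℕ → List Step → Vec ℕ n → Set
WeightFrom H p D w = ∀ k → Vec.lookup w k ≤ (heightFrom H D (p + 2 * toℕ k) ∸ 1) / 2

2h+1 : ℕ → ℕ
2h+1 h = suc (h * 2)

half : ∀ h D → (heightFrom (2h+1 h) D 0 ∸ 1) / 2 ≡ h
half h D = trans (cong (λ z → (z ∸ 1) / 2) (heightFrom-zero (2h+1 h) D)) (m*n/n≡m h 2)

bound : ℕ → ℕ
bound H = (H ∸ 1) / 2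

bnd : ∀ {t H H′} → H ≡ H′ → t ≤ bound H → t ≤ bound H′
bnd refl p = p

dbl : ∀ k → 2 * suc k ≡ suc (suc (2 * k))
dbl k = cong suc (+-suc k (k + 0))

even-sound : ∀ {n h D} {w : Vec ℕ n} → EvenFrom h D w → DyckFrom (h * 2) (n * 2) D × WeightFrom (h * 2) 1 D w
odd-sound  : ∀ {n h D} {w : Vec ℕ (suc n)} → OddFrom h D w →
             DyckFrom (2h+1 h) (suc (n * 2)) D × WeightFrom (2h+1 h) 0 D w
even-sound end = mkDF refl refl (λ { zero → z≤n ; (suc i) → z≤n }) , λ ()
even-sound {h = h} {D = _ ∷ D} {w = _ ∷ _} (up o) = let d , b = odd-sound o in up-from d ,
  λ k → bnd (sym (heightFrom-up (h * 2) D (2 * toℕ k))) (b k)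
even-sound {h = suc h} {w = _ ∷ _} (down o) = let d , b = odd-sound o in down-from d , b
odd-sound {h = h} {D = _ ∷ D} (up {w = w} t≤h e) = let d , b = even-sound e in up-from d , λ
  { Fin.zero    → subst (_ ≤_) (sym (half h (up ∷ D))) t≤h
  ; (Fin.suc k) → subst (λ i → Vec.lookup w k ≤ bound (heightFrom (2h+1 h) (up ∷ D) i)) (sym (dbl (toℕ k)))
                    (bnd (sym (heightFrom-up (2h+1 h) D (suc (2 * toℕ k)))) (b k)) }
odd-sound {h = h} {D = _ ∷ D} (down {w = w} t≤h e) = let d , b = even-sound e in down-from d , λ
  { Fin.zero    → subst (_ ≤_) (sym (half h (down ∷ D))) t≤h
  ; (Fin.suc k) → subst (λ i → Vec.lookup w k ≤ bound (heightFrom (2h+1 h) (down ∷ D) i)) (sym (dbl (toℕ k))) (b k) }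

even-complete : ∀ {n} h D (w : Vec ℕ n) → DyckFrom (h * 2) (n * 2) D → WeightFrom (h * 2) 1 D w → EvenFrom h D w
odd-complete  : ∀ {n} h D (w : Vec ℕ (suc n)) → DyckFrom (2h+1 h) (suc (n * 2)) D →
                WeightFrom (2h+1 h) 0 D w → OddFrom h D w
even-complete zero    [] [] d b = end
even-complete (suc h) [] [] d b with level d
... | ()
even-complete h [] (_ ∷ _) d b with len d
... | ()
even-complete h (_ ∷ D) [] d b with len d
... | ()
even-complete h (up ∷ D) w@(_ ∷ _) d b = up (odd-complete h D w (up-to d)
  λ k → bnd (heightFrom-up (h * 2) D (2 * toℕ k)) (b k))
even-complete zero (down ∷ D) w d b with above d 1
... | ()
even-complete (suc h) (down ∷ D) w@(_ ∷ _) d b = down (odd-complete h D w (down-to d) b)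
odd-complete h [] w d b with len d
... | ()
odd-complete h (up ∷ D) (t ∷ w) d b = up (subst (t ≤_) (half h (up ∷ D)) (b Fin.zero))
  (even-complete (suc h) D w (up-to d)
    λ k → bnd (heightFrom-up (2h+1 h) D (suc (2 * toℕ k)))
            (subst (λ i → Vec.lookup w k ≤ bound (heightFrom (2h+1 h) (up ∷ D) i)) (dbl (toℕ k)) (b (Fin.suc k))))
odd-complete h (down ∷ D) (t ∷ w) d b = down (subst (t ≤_) (half h (down ∷ D)) (b Fin.zero))
  (even-complete h D w (down-to d)
    λ k → subst (λ i → Vec.lookup w k ≤ bound (heightFrom (2h+1 h) (down ∷ D) i)) (dbl (toℕ k)) (b (Fin.suc k)))

length-steps : ∀ D → length D ≡ ups D + downs D
length-steps []         = refl
length-steps (up   ∷ D) = cong suc (length-steps D)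
length-steps (down ∷ D) = trans (cong suc (length-steps D)) (sym (+-suc (ups D) (downs D)))

*2-injective : ∀ a n → a + a ≡ n * 2 → a ≡ n
*2-injective zero    zero    e = refl
*2-injective (suc a) (suc n) e = cong suc (*2-injective a n (suc-injective (trans (sym (+-suc a a)) (suc-injective e))))

twice : ∀ n → n + n ≡ n * 2
twice zero    = refl
twice (suc n) = cong suc (trans (+-suc n n) (cong suc (twice n)))

toWDP : ∀ {n D} {w : Vec ℕ n} → EvenFrom 0 D w → WeightedDyckPath n
toWDP {n} {D} {w} e = mkWDP D w
  record { n-ups = u ; n-downs = trans (sym (level d)) u ; never-below = above d } b
  where
  d = proj₁ (even-sound e)
  b = proj₂ (even-sound e)
  u : ups D ≡ n
  u = *2-injective (ups D) n (trans (cong (ups D +_) (level d)) (trans (sym (length-steps D)) (len d)))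

fromWDP : ∀ {n} (d : WeightedDyckPath n) → EvenFrom 0 (path d) (weight d)
fromWDP {n} d = even-complete 0 (path d) (weight d)
  (mkDF (trans (length-steps (path d)) (trans (cong₂ _+_ n-ups n-downs) (twice n)))
        (trans n-ups (sym n-downs)) never-below)
  (weight-bound d)
  where open IsDyckPath (isDyckPath d)

swap-pairs-valid : ∀ {n h D} {w : Vec ℕ n} → OddFrom h D w → OddFrom h (swap-pairs D) w
swap-pairs-valid (up   p (up o))   = up p (up (swap-pairs-valid o))
swap-pairs-valid (up   p (down o)) = down p (up (swap-pairs-valid o))
swap-pairs-valid (down p (up o))   = up p (down (swap-pairs-valid o))
swap-pairs-valid (down p (down o)) = down p (down (swap-pairs-valid o))
swap-pairs-valid (down p end)      = down p end

ψ-valid : ∀ {n D} {w : Vec ℕ n} → EvenFrom 0 D w → EvenFrom 0 (ψ-path D) w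
ψ-valid end    = end
ψ-valid (up o) = up (swap-pairs-valid o)

ψ : ∀ {n} → WeightedDyckPath n → WeightedDyckPath n
ψ d = toWDP (ψ-valid (fromWDP d))

data Cls : Set where
  small eq big : Cls

cls : ℕ → ℕ → Cls
cls zero    zero    = eq
cls zero    (suc x) = big
cls (suc k) zero    = small
cls (suc k) (suc x) = cls k x

cls-< : ∀ {k x} → x < k → cls k x ≡ small
cls-< {suc k} {zero}  _       = refl
cls-< {suc k} {suc x} (s≤s p) = cls-< p

cls-refl : ∀ k → cls k k ≡ eq
cls-refl zero    = refl
cls-refl (suc k) = cls-refl k

cls-> : ∀ {k x} → k < x → cls k x ≡ big
cls-> {zero}  {suc x} _       = refl
cls-> {suc k} {suc x} (s≤s p) = cls-> p

cls-small : ∀ k x → cls k x ≡ small → x < k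
cls-small (suc k) zero    _ = s≤s z≤n
cls-small (suc k) (suc x) e = s≤s (cls-small k x e)

cls-eq : ∀ k x → cls k x ≡ eq → x ≡ k
cls-eq zero    zero    _ = refl
cls-eq (suc k) (suc x) e = cong suc (cls-eq k x e)

cls-big : ∀ k x → cls k x ≡ big → k < x
cls-big zero    (suc x) _ = s≤s z≤n
cls-big (suc k) (suc x) e = s≤s (cls-big k x e)

isSmall isBig : Cls → Bool
isSmall small = true
isSmall _     = false
isBig big = true
isBig _   = false

does-< : ∀ k x → does (x <? k) ≡ isSmall (cls k x)
does-< zero    zero    = refl
does-< zero    (suc x) = refl
does-< (suc k) zero    = refl
does-< (suc k) (suc x) = does-< k x

does-> : ∀ k x → does (k <? x) ≡ isBig (cls k x)
does-> zero    zero    = refl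
does-> zero    (suc x) = refl
does-> (suc k) zero    = refl
does-> (suc k) (suc x) = does-> k x

-- The rest of the file shows that the two maps land in weighted Dyck paths and that ψ⁰FV
-- is invertible.  The inverse inserts the values 1,…,n successively into a word with gaps
-- (the places where larger values are still to come), the weight telling which gap to use.

-- Reading a word from left to right, for a fixed value k: before k is met, the side of
-- the last letter and the number of descents across k so far; afterwards, the sides of
-- the left neighbour, the number of descents, and the side of the right neighbour.
data State : Set where
  before : Step → ℕ → State
  at     : Step → ℕ → State
  after  : Step → ℕ → Step → State

bump : Step → ℕ → ℕ
bump up   c = suc c
bump down c = c

trans-st : Cls → State → State
trans-st small (before p c)  = before down (bump p c)
trans-st eq    (before p c)  = at p c
trans-st big   (before p c)  = before up c
trans-st small (at p c)      = after p c down
trans-st eq    (at p c)      = after p c down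
trans-st big   (at p c)      = after p c up
trans-st _     (after p c r) = after p c r

run : ℕ → State → List ℕ → State
run k s []      = s
run k s (x ∷ W) = run k (trans-st (cls k x) s) W

finish : State → State
finish (at p c) = after p c down
finish s        = s

run-++ : ∀ k s U V → run k s (U ++ V) ≡ run k (run k s U) V
run-++ k s []      V = refl
run-++ k s (x ∷ U) V = run-++ k _ U V

trans-after : ∀ z {p c r} → trans-st z (after p c r) ≡ after p c r
trans-after small = refl
trans-after eq    = refl
trans-after big   = refl

run-after : ∀ k {p c r} W → run k (after p c r) W ≡ after p c r
run-after k []      = refl
run-after k {p} {c} {r} (x ∷ W) rewrite trans-after (cls k x) {p} {c} {r} = run-after k W

-- Sides of the neighbours and number of descents, read off an infinite word f.

lside rside : ℕ → ℕ → Step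
lside k x = if does (x <? k) then down else up
rside k x = if does (k <? x) then up else down

desc? : (ℕ → ℕ) → ℕ → ℕ → ℕ → Bool
desc? f k j i = does ((suc i <? j) ×-dec ((f (suc i) <? k) ×-dec (k <? f i)))

cnt : (ℕ → Bool) → ℕ → ℕ
cnt P zero    = 0
cnt P (suc M) = (if P 0 then suc else (λ c → c)) (cnt (P ∘ suc) M)

cnt-false : ∀ P M → (∀ i → P i ≡ false) → cnt P M ≡ 0
cnt-false P zero    h = refl
cnt-false P (suc M) h rewrite h 0 = cnt-false (P ∘ suc) M (h ∘ suc)

lside-cls : ∀ k x → lside k x ≡ (if isSmall (cls k x) then down else up)
lside-cls k x rewrite does-< k x = refl

rside-cls : ∀ k x → rside k x ≡ (if isBig (cls k x) then up else down)
rside-cls k x rewrite does-> k x = refl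

run-index : ∀ (f : ℕ → ℕ) k j M c → j < M → (∀ i → i ≤ j → f i ≢ k) → f (suc j) ≡ k →
            run k (before (lside k (f 0)) c) (applyUpTo (f ∘ suc) (suc M))
            ≡ after (lside k (f j)) (c + cnt (desc? f k (suc j)) (suc M)) (rside k (f (suc (suc j))))
run-index f k zero (suc M) c _ _ e
  rewrite e | cls-refl k
        | cnt-false (desc? f k 1) (suc (suc M)) (λ { zero → refl ; (suc i) → refl })
        | +-identityʳ c | rside-cls k (f 2)
  with cls k (f 2)
... | small = run-after k (applyUpTo (λ x → f (suc (suc (suc x)))) M)
... | eq    = run-after k (applyUpTo (λ x → f (suc (suc (suc x)))) M)
... | big   = run-after k (applyUpTo (λ x → f (suc (suc (suc x)))) M)
run-index f k (suc j) (suc M) c (s≤s j<M) ne e = trans (cong (λ s → run k s (applyUpTo (f ∘ suc ∘ suc) (suc M))) first)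
   (trans (run-index (f ∘ suc) k j M c′ j<M (λ i i≤j → ne (suc i) (s≤s i≤j)) e)
     (cong (λ z → after (lside k (f (suc j))) z (rside k (f (suc (suc (suc j)))))) counts))
  where
  b : Bool
  b = isSmall (cls k (f 1)) ∧ isBig (cls k (f 0))
  c′ : ℕ
  c′ = (if b then suc else (λ c → c)) c
  first : trans-st (cls k (f 1)) (before (lside k (f 0)) c) ≡ before (lside k (f 1)) c′
  first rewrite lside-cls k (f 0) | lside-cls k (f 1) with cls k (f 1) in e1 | cls k (f 0) in e0
  ... | small | small = refl
  ... | small | eq    = ⊥-elim (ne 0 z≤n (cls-eq k _ e0))
  ... | small | big   = refl
  ... | eq    | _     = ⊥-elim (ne 1 (s≤s z≤n) (cls-eq k _ e1))
  ... | big   | _     = refl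
  d0 : desc? f k (suc (suc j)) 0 ≡ b
  d0 rewrite does-< k (f 1) | does-> k (f 0) = refl
  counts : c′ + cnt (desc? (f ∘ suc) k (suc j)) (suc M) ≡ c + cnt (desc? f k (suc (suc j))) (suc (suc M))
  counts rewrite d0 with b
  ... | true  = sym (+-suc c _)
  ... | false = refl

cnt-cong : ∀ {P Q : ℕ → Bool} M → (∀ i → i < M → P i ≡ Q i) → cnt P M ≡ cnt Q M
cnt-cong zero    h = refl
cnt-cong {P} {Q} (suc M) h rewrite h 0 (s≤s z≤n) = cong (if Q 0 then suc else (λ c → c)) (cnt-cong M (λ i p → h (suc i) (s≤s p)))

length-filter : ∀ {P : ℕ → Set} (P? : Decidable P) (g : ℕ → ℕ) M →
                length (filter P? (applyUpTo g M)) ≡ cnt (λ i → does (P? (g i))) M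
length-filter P? g zero    = refl
length-filter P? g (suc M) with does (P? (g 0))
... | true  = cong suc (length-filter P? (g ∘ suc) M)
... | false = length-filter P? (g ∘ suc) M

module _ {n : ℕ} (σ : Permutation′ n) where

  letter-toℕ : ∀ e (i : Fin n) → letter e σ (suc (toℕ i)) ≡ ⟦ σ ⟨$⟩ʳ i ⟧
  letter-toℕ e i with toℕ i <? n
  ... | yes p = cong (λ j → ⟦ σ ⟨$⟩ʳ j ⟧) (fromℕ<-toℕ i p)
  ... | no ¬p = ⊥-elim (¬p (toℕ<n i))

  letter-end : ∀ e → letter e σ (suc n) ≡ e
  letter-end e with n <? n
  ... | yes p = ⊥-elim (<-irrefl refl p)
  ... | no _  = refl

  letter-indep : ∀ e i → i ≤ n → letter e σ i ≡ letter 0 σ i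
  letter-indep e zero    _ = refl
  letter-indep e (suc i) p with i <? n
  ... | yes _ = refl
  ... | no ¬p = ⊥-elim (¬p p)

  applyUpTo-tabulate : ∀ (g : ℕ → ℕ) m → applyUpTo g (suc m) ≡ tabulate {n = m} (g ∘ toℕ) ++ g m ∷ []
  applyUpTo-tabulate g zero    = refl
  applyUpTo-tabulate g (suc m) = cong (g 0 ∷_) (applyUpTo-tabulate (g ∘ suc) m)

  word-end : ∀ e → applyUpTo (letter e σ ∘ suc) (suc n) ≡ word σ ++ e ∷ []
  word-end e = trans (applyUpTo-tabulate (letter e σ ∘ suc) n)
    (cong₂ (λ W x → W ++ x ∷ []) (tabulate-cong (letter-toℕ e)) (letter-end e))

  letter-pos : ∀ e k → letter e σ (pos σ k) ≡ ⟦ k ⟧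
  letter-pos e k = trans (letter-toℕ e (σ ⟨$⟩ˡ k)) (cong ⟦_⟧ (inverseʳ σ))

  letter-unique : ∀ e (k : Fin n) i → i < pos σ k → letter e σ i ≢ ⟦ k ⟧
  letter-unique e k zero    _ ()
  letter-unique e k (suc i) (s≤s i<j) h with i <? n
  ... | no ¬p = ¬p (<-trans i<j (toℕ<n _))
  ... | yes p = <-irrefl lem i<j
    where
    lem : i ≡ toℕ (σ ⟨$⟩ˡ k)
    lem = trans (sym (toℕ-fromℕ< p)) (cong toℕ (trans (sym (inverseˡ σ))
            (cong (σ ⟨$⟩ˡ_) (toℕ-injective (suc-injective h)))))

  tot-cnt : ∀ e k → tot σ k ≡ cnt (desc? (letter e σ) ⟦ k ⟧ (pos σ k)) (suc n)
  tot-cnt e k = trans (length-filter (λ i → (suc i <? pos σ k) ×-dec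
                         ((letter 0 σ (suc i) <? ⟦ k ⟧) ×-dec (⟦ k ⟧ <? letter 0 σ i))) suc n)
    (trans (cnt-cong n (λ i _ → same (suc i)))
     (sym (cong (λ b → (if b then suc else (λ c → c)) (cnt (desc? (letter e σ) ⟦ k ⟧ (pos σ k) ∘ suc) n)) zeroth)))
    where
    zeroth : desc? (letter e σ) ⟦ k ⟧ (pos σ k) 0 ≡ false
    zeroth with does (1 <? pos σ k) | does (letter e σ 1 <? ⟦ k ⟧)
    ... | false | _ = refl
    ... | true | false = refl
    ... | true | true = refl
    le : ∀ i → suc i < pos σ k → suc i ≤ n
    le i p = ≤-trans (≤-pred p) (≤-trans (n≤1+n _) (toℕ<n (σ ⟨$⟩ˡ k)))
    same : ∀ i → desc? (letter 0 σ) ⟦ k ⟧ (pos σ k) i ≡ desc? (letter e σ) ⟦ k ⟧ (pos σ k) i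
    same i with suc i <? pos σ k
    ... | yes p = cong₂ (λ a b → does (suc i <? pos σ k) ∧ (does (a <? ⟦ k ⟧) ∧ does (⟦ k ⟧ <? b)))
                    (sym (letter-indep e (suc i) (le i p))) (sym (letter-indep e i (≤-trans (n≤1+n i) (le i p))))
    ... | no ¬p = trans (cong (_∧ rest 0) (dec-false (suc i <? pos σ k) ¬p))
                        (sym (cong (_∧ rest e) (dec-false (suc i <? pos σ k) ¬p)))
      where rest : ℕ → Bool
            rest e = does (letter e σ (suc i) <? ⟦ k ⟧) ∧ does (⟦ k ⟧ <? letter e σ i)

  run-word : ∀ e k → run ⟦ k ⟧ (before down 0) (word σ ++ e ∷ [])
                     ≡ after (left-step e σ k) (tot σ k) (right-step e σ k)
  run-word e k = trans (cong (run ⟦ k ⟧ (before down 0)) (sym (word-end e)))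
    (trans (run-index (letter e σ) ⟦ k ⟧ (toℕ (σ ⟨$⟩ˡ k)) n 0 (toℕ<n _)
              (λ i i≤j → letter-unique e k i (s≤s i≤j)) (letter-pos e k))
      (cong (λ t → after (left-step e σ k) t (right-step e σ k)) (sym (tot-cnt e k))))

small? : ℕ → ℕ → Bool
small? k x = isSmall (cls k x)

small-< : ∀ {k x} → x < k → small? k x ≡ true
small-< p = cong isSmall (cls-< p)

small-≥ : ∀ {k x} → k ≤ x → small? k x ≡ false
small-≥ {zero}  {zero}  _       = refl
small-≥ {zero}  {suc x} _       = refl
small-≥ {suc k} {suc x} (s≤s p) = small-≥ p

<-small : ∀ k x → small? k x ≡ true → x < k
<-small k x e with cls k x in q
... | small = cls-small k x q

≥-small : ∀ k x → small? k x ≡ false → k ≤ x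
≥-small k x e with cls k x in q
... | eq  = ≤-reflexive (sym (cls-eq k x q))
... | big = <⇒≤ (cls-big k x q)

small-suc : ∀ k x → x ≢ k → small? (suc k) x ≡ small? k x
small-suc zero    zero    ne = ⊥-elim (ne refl)
small-suc zero    (suc x) ne = small-≥ {1} {suc x} (s≤s z≤n)
small-suc (suc k) zero    ne = refl
small-suc (suc k) (suc x) ne = small-suc k x (λ e → ne (cong suc e))

data Once (k : ℕ) : List ℕ → Set where
  here  : ∀ {W} → All (_≢ k) W → Once k (k ∷ W)
  there : ∀ {x W} → x ≢ k → Once k W → Once k (x ∷ W)

bit : Step → ℕ
bit up   = 1
bit down = 0

-- N marks a gap; the genuine letters are smaller.
module Gaps (N : ℕ) where

  gap : Step → List ℕ
  gap up   = N ∷ []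
  gap down = []

  -- collapse k down W replaces every maximal run of letters ≥ k by a gap
  collapse : ℕ → Step → List ℕ → List ℕ
  collapse k p []      = gap p
  collapse k p (x ∷ W) with small? k x
  ... | true  = gap p ++ x ∷ collapse k down W
  ... | false = collapse k up W

  gaps : List ℕ → ℕ
  gaps []      = 0
  gaps (x ∷ W) = (if small? N x then 0 else 1) + gaps W

  -- insert k t l r W puts k in the gap number t of W, leaving a gap on its left if l = up
  -- and on its right if r = up
  insert : ℕ → ℕ → Step → Step → List ℕ → List ℕ
  insert k t l r []      = []
  insert k t l r (x ∷ W) with small? N x
  ... | true  = x ∷ insert k t l r W
  insert k zero    l r (x ∷ W) | false = gap l ++ k ∷ gap r ++ W
  insert k (suc t) l r (x ∷ W) | false = x ∷ insert k t l r W

  small?-N : small? N N ≡ false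
  small?-N = small-≥ {N} ≤-refl

  insert-gap-zero : ∀ {k l r} W → insert k 0 l r (N ∷ W) ≡ gap l ++ k ∷ gap r ++ W
  insert-gap-zero W rewrite small?-N = refl

  insert-gap-suc : ∀ {k t l r} W → insert k (suc t) l r (N ∷ W) ≡ N ∷ insert k t l r W
  insert-gap-suc W rewrite small?-N = refl

  insert-small : ∀ {k t l r x} W → x < N → insert k t l r (x ∷ W) ≡ x ∷ insert k t l r W
  insert-small {x = x} W p rewrite small-< p = refl

  gaps-gap : ∀ W → gaps (N ∷ W) ≡ suc (gaps W)
  gaps-gap W rewrite small?-N = refl

  gaps-small : ∀ {x} W → x < N → gaps (x ∷ W) ≡ gaps W
  gaps-small W p rewrite small-< p = refl

  gaps-gap-++ : ∀ p W → gaps (gap p ++ W) ≡ bit p + gaps W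
  gaps-gap-++ up   W = gaps-gap W
  gaps-gap-++ down W = refl

  collapse-small : ∀ {k x} p W → x < k → collapse k p (x ∷ W) ≡ gap p ++ x ∷ collapse k down W
  collapse-small p W h rewrite small-< h = refl

  collapse-big : ∀ {k x} p W → k ≤ x → collapse k p (x ∷ W) ≡ collapse k up W
  collapse-big p W h rewrite small-≥ h = refl

  collapse-suc : ∀ {k} p W → All (_≢ k) W → collapse (suc k) p W ≡ collapse k p W
  collapse-suc p [] [] = refl
  collapse-suc {k} p (x ∷ W) (ne ∷ a) rewrite small-suc k x ne with small? k x
  ... | true  = cong (λ z → gap p ++ x ∷ z) (collapse-suc down W a)
  ... | false = collapse-suc up W a

  collapse-up : ∀ k W → ∃ λ T → collapse k up W ≡ N ∷ T
  collapse-up k [] = _ , refl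
  collapse-up k (x ∷ W) with small? k x
  ... | true  = _ , refl
  ... | false = collapse-up k W

  data EndsN : List ℕ → Set where
    last : EndsN (N ∷ [])
    more : ∀ {x W} → EndsN W → EndsN (x ∷ W)

  ends-gaps : ∀ k p {W} → k ≤ N → EndsN W → 1 ≤ gaps (collapse k p W)
  ends-gaps k p kN last rewrite small-≥ kN | small?-N = s≤s z≤n
  ends-gaps k p kN (more {x} {W} e) with small? k x
  ... | true  = ≤-trans (≤-trans (ends-gaps k down kN e) (m≤n+m _ (if small? N x then 0 else 1)))
                  (≤-trans (m≤n+m _ (bit p)) (≤-reflexive (sym (gaps-gap-++ p (x ∷ collapse k down W)))))
  ... | false = ends-gaps k up kN e

  Stage : ℕ → Step → ℕ → List ℕ → Set
  Stage k p c W = ∃ λ t → ∃ λ l → ∃ λ r →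
    (finish (run k (before p c) W) ≡ after l (c + t) r) ×
    (t < gaps (collapse k p W)) ×
    (EndsN W → r ≡ down → suc t < gaps (collapse k p W)) ×
    (insert k t l r (collapse k p W) ≡ collapse (suc k) p W)

  ne-≤ : ∀ k x → x ≢ k → small? k x ≡ false → k < x
  ne-≤ k x ne e = ≤∧≢⇒< (≥-small k x e) (λ q → ne (sym q))

  once-[] : ∀ {k} → Once k [] → ⊥
  once-[] ()

  stage : ∀ {k} → k < N → ∀ p c {W} → Once k W → Stage k p c W
  stage {k} kN p c {.k ∷ []} (here []) rewrite cls-refl k | small-< (n<1+n k) | gaps-gap [] =
    0 , p , down , cong (λ z → after p z down) (sym (+-identityʳ c)) , s≤s z≤n
      , (λ { last _ → ⊥-elim (<-irrefl refl kN) ; (more ()) _ }) , insert-gap-zero []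
  stage {k} kN p c {.k ∷ x ∷ W} (here (ne ∷ a)) with small? k x in e
  ... | true rewrite cls-refl k | small-< (n<1+n k) | e | small-suc k x ne | e | cls-< (<-small k x e)
                   | gaps-gap (x ∷ collapse k down W) | collapse-suc down W a | small-< (<-trans (<-small k x e) kN) =
    0 , p , down , trans (cong finish (run-after k W)) (cong (λ z → after p z down) (sym (+-identityʳ c))) , s≤s z≤n
      , (λ { (more (more q)) _ → s≤s (ends-gaps k down (<⇒≤ kN) q) ; (more last) _ → ⊥-elim (<-asym kN (<-small k x e)) })
      , insert-gap-zero (x ∷ collapse k down W)
  ... | false rewrite cls-refl k | small-< (n<1+n k) | e | small-suc k x ne | e | cls-> (ne-≤ k x ne e)
                   | collapse-suc up W a | proj₂ (collapse-up k W) | gaps-gap (proj₁ (collapse-up k W)) =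
    0 , p , up , trans (cong finish (run-after k W)) (cong (λ z → after p z up) (sym (+-identityʳ c))) , s≤s z≤n
      , (λ _ ()) , insert-gap-zero (proj₁ (collapse-up k W))
  stage {k} kN p c {x ∷ W} (there ne o) with small? k x in e
  ... | false rewrite small-suc k x ne | e | cls-> (ne-≤ k x ne e) with stage kN up c o
  ...   | t , l , r , stats , t< , inner , next =
    t , l , r , stats , t< , (λ { (more q) → inner q ; last → ⊥-elim (once-[] o) }) , next
  stage {k} kN p c {x ∷ W} (there ne o) | true rewrite small-suc k x ne | e | cls-< (<-small k x e) with p
  ...   | down with stage kN down c o
  ...     | t , l , r , stats , t< , inner , next rewrite small-< (<-trans (<-small k x e) kN) =
    t , l , r , stats , t< , (λ { (more q) → inner q ; last → ⊥-elim (once-[] o) }) , cong (x ∷_) next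
  stage {k} kN p c {x ∷ W} (there ne o) | true | up with stage kN down (suc c) o
  ...     | t , l , r , stats , t< , inner , next rewrite small?-N | small-< (<-trans (<-small k x e) kN) =
    suc t , l , r , trans stats (cong (λ z → after l z r) (sym (+-suc c t))) , s≤s t<
      , (λ { (more q) d → s≤s (inner q d) ; last → ⊥-elim (once-[] o) }) , cong (N ∷_) (trans (insert-small _ (<-trans (<-small k x e) kN)) (cong (x ∷_) next))

module Insertion (N : ℕ) where
  open Gaps N public

  insert-gaps : ∀ {k} → k < N → ∀ t l r W → t < gaps W →
                suc (gaps (insert k t l r W)) ≡ bit l + bit r + gaps W
  insert-gaps kN t l r (x ∷ W) p with small? N x in e
  ... | true rewrite e = insert-gaps kN t l r W p
  insert-gaps {k} kN zero l r (x ∷ W) p | false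
    rewrite gaps-gap-++ l (k ∷ gap r ++ W) | small-< kN | gaps-gap-++ r W
          | +-suc (bit l + bit r) (gaps W) | +-assoc (bit l) (bit r) (gaps W) = refl
  insert-gaps kN (suc t) l r (x ∷ W) (s≤s p) | false
    rewrite e | insert-gaps kN t l r W p | +-suc (bit l + bit r) (gaps W) = refl

  -- no two adjacent gaps, and the genuine letters are < k
  data Spread (k : ℕ) : Step → List ℕ → Set where
    []  : ∀ {p} → Spread k p []
    _∷_ : ∀ {p x W} → x < k → Spread k down W → Spread k p (x ∷ W)
    hole : ∀ {W} → Spread k up W → Spread k down (N ∷ W)

  spread-suc : ∀ {k p W} → Spread k p W → Spread (suc k) p W
  spread-suc []      = []
  spread-suc (q ∷ s) = m<n⇒m<1+n q ∷ spread-suc s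
  spread-suc (hole s) = hole (spread-suc s)

  spread-down : ∀ {k W} → Spread k up W → Spread k down W
  spread-down []      = []
  spread-down (q ∷ s) = q ∷ s

  insert-spread : ∀ {k} → k < N → ∀ t l r {p W} → Spread k p W → Spread (suc k) p (insert k t l r W)
  insert-spread kN t l r [] = []
  insert-spread {k} kN t l r (_∷_ {x = x} q s) rewrite small-< (<-trans q kN) =
    m<n⇒m<1+n q ∷ insert-spread kN t l r s
  insert-spread {k} kN zero l r (hole {W} s) rewrite small?-N = left l (right r)
    where
    right : ∀ r → Spread (suc k) down (gap r ++ W)
    right up   = hole (spread-suc s)
    right down = spread-down (spread-suc s)
    left : ∀ l {V} → Spread (suc k) down V → Spread (suc k) down (gap l ++ k ∷ V)
    left up   v = hole (n<1+n k ∷ v)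
    left down v = n<1+n k ∷ v
  insert-spread kN (suc t) l r (hole s) rewrite small?-N = hole (insert-spread kN t l r s)

  insert-stats : ∀ {k} → k < N → ∀ t l r {p c W} → Spread k p W → t < gaps W →
                 finish (run k (before p c) (insert k t l r W)) ≡ after l (bit p + c + t) r
  insert-stats {k} kN t l r {p} {c} (_∷_ {x = x} {W} q s) t< rewrite small-< (<-trans q kN) | cls-< q =
    trans (insert-stats kN t l r s t<) (cong (λ z → after l (z + t) r) (bump-bit p))
    where bump-bit : ∀ p → bump p c ≡ bit p + c
          bump-bit up   = refl
          bump-bit down = refl
  insert-stats {k} kN zero l r {c = c} (hole {W} s) t< rewrite small?-N | +-identityʳ c =
    trans (left l (gap r ++ W)) (right r s)
    where
    left : ∀ l V → finish (run k (before down c) (gap l ++ k ∷ V)) ≡ finish (run k (at l c) V)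
    left up   V rewrite cls-> kN | cls-refl k = refl
    left down V rewrite cls-refl k = refl
    right : ∀ r {W} → Spread k up W → finish (run k (at l c) (gap r ++ W)) ≡ after l c r
    right up {W} s rewrite cls-> kN = cong finish (run-after k W)
    right down [] = refl
    right down (_∷_ {W = W} q s) rewrite cls-< q = cong finish (run-after k W)
  insert-stats {k} kN (suc t) l r {c = c} (hole s) t< rewrite small?-N | cls-> kN =
    trans (insert-stats kN t l r s (≤-pred t<)) (cong (λ z → after l z r) (sym (+-suc c t)))

  big-big : ∀ s → trans-st big (trans-st big s) ≡ trans-st big s
  big-big (before p c)  = refl
  big-big (at p c)      = refl
  big-big (after p c r) = refl

  insert-preserves : ∀ {j k} → j < k → k < N → ∀ t l r s W → run j s (insert k t l r W) ≡ run j s W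
  insert-preserves jk kN t l r s [] = refl
  insert-preserves jk kN t l r s (x ∷ W) with small? N x in e
  ... | true = insert-preserves jk kN t l r _ W
  insert-preserves {j} {k} jk kN zero l r s (x ∷ W) | false rewrite cls-> (<-≤-trans (<-trans jk kN) (≥-small N x e)) =
    trans (left l s (gap r ++ W)) (right r)
    where
    left : ∀ l s V → run j s (gap l ++ k ∷ V) ≡ run j (trans-st big s) V
    left up s V rewrite cls-> jk | cls-> (<-trans jk kN) | big-big s = refl
    left down s V rewrite cls-> jk = refl
    right : ∀ r → run j (trans-st big s) (gap r ++ W) ≡ run j (trans-st big s) W
    right up rewrite cls-> (<-trans jk kN) | big-big s = refl
    right down = refl
  insert-preserves jk kN (suc t) l r s (x ∷ W) | false = insert-preserves jk kN t l r _ W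

  insert-↭ : ∀ {k} → k < N → ∀ t l r {p W} → Spread k p W → t < gaps W →
             N ∷ insert k t l r W ↭ k ∷ (gap l ++ gap r) ++ W
  insert-↭ {k} kN t l r (_∷_ {x = x} {W} q s) t< rewrite small-< (<-trans q kN) =
    ↭-trans (↭-swap N x ↭-refl) (↭-trans (↭-prep x (insert-↭ kN t l r s t<))
      (↭-sym (↭.shift x (k ∷ gap l ++ gap r) W)))
  insert-↭ {k} kN zero l r (hole {W} s) t< rewrite small?-N = lem l r
    where
    lem : ∀ l r → N ∷ gap l ++ k ∷ gap r ++ W ↭ k ∷ (gap l ++ gap r) ++ N ∷ W
    lem up   up   = ↭.shift k (N ∷ N ∷ []) (N ∷ W)
    lem up   down = ↭.shift k (N ∷ N ∷ []) W
    lem down up   = ↭.shift k (N ∷ []) (N ∷ W)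
    lem down down = ↭.shift k (N ∷ []) W
  insert-↭ {k} kN (suc t) l r (hole {W} s) t< rewrite small?-N =
    ↭-trans (↭-prep N (insert-↭ kN t l r s (≤-pred t<))) (↭-sym (↭.shift N (k ∷ gap l ++ gap r) W))

  vals : ℕ → List ℕ
  vals zero    = []
  vals (suc a) = suc a ∷ vals a

  record Invariant (a h : ℕ) (W : List ℕ) : Set where
    field
      ngaps  : gaps W ≡ suc h
      spread : Spread (suc a) down W
      perm   : W ↭ replicate (gaps W) N ++ vals a
  open Invariant public

  insert-perm : ∀ {a} → suc a < N → ∀ t l r {W} → Spread (suc a) down W → t < gaps W →
    W ↭ replicate (gaps W) N ++ vals a →
    let W′ = insert (suc a) t l r W in W′ ↭ replicate (gaps W′) N ++ vals (suc a)
  insert-perm {a} aN t l r {W} s t< p = ↭.drop-∷ (↭-trans (insert-↭ aN t l r s t<)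
    (↭-trans (↭-prep (suc a) (↭-trans (↭.++⁺ˡ (gap l ++ gap r) p) (↭-reflexive eq′)))
      (↭-sym (↭.shift (suc a) (replicate (suc (gaps W′)) N) (vals a)))))
    where
    W′ = insert (suc a) t l r W
    reps : ∀ l r g → (gap l ++ gap r) ++ replicate g N ++ vals a ≡ replicate (bit l + bit r + g) N ++ vals a
    reps up   up   g = refl
    reps up   down g = refl
    reps down up   g = refl
    reps down down g = refl
    eq′ : (gap l ++ gap r) ++ replicate (gaps W) N ++ vals a ≡ replicate (suc (gaps W′)) N ++ vals a
    eq′ = trans (reps l r (gaps W)) (cong (λ g → replicate g N ++ vals a) (sym (insert-gaps aN t l r W t<)))

  -- the insertion algorithm, reading the path without its first step
  build : ∀ {n} → ℕ → List Step → Vec ℕ n → List ℕ → List ℕ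
  build k D           []      W = W
  build k []          (t ∷ w) W = W
  build k (_ ∷ [])    (t ∷ w) W = insert k t down down W
  build k (r ∷ l ∷ D) (t ∷ w) W = build (suc k) D w (insert k t l r W)

  data Reads (F : List ℕ) : ∀ {n} → ℕ → List Step → Vec ℕ n → Set where
    final : ∀ {k} → Reads F k (down ∷ []) (0 ∷ [])
    _∷_   : ∀ {n k r l D t} {w : Vec ℕ n} → finish (run k (before down 0) F) ≡ after l t r →
            Reads F (suc k) D w → Reads F k (r ∷ l ∷ D) (t ∷ w)

  next-invariant : ∀ {a h h′} → suc a < N → ∀ t l r {W} → t ≤ h → Invariant a h W → bit l + bit r + h ≡ suc h′ →
                   Invariant (suc a) h′ (insert (suc a) t l r W)
  next-invariant {h = h} aN t l r {W} t≤h I e = record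
    { ngaps  = suc-injective (trans (insert-gaps aN t l r W t<)
                 (trans (cong (bit l + bit r +_) (ngaps I)) (trans (+-suc (bit l + bit r) h) (cong suc e))))
    ; spread = insert-spread aN t l r (spread I)
    ; perm   = insert-perm aN t l r (spread I) t< (perm I) }
    where t< = subst (t <_) (sym (ngaps I)) (s≤s t≤h)

  shift-< : ∀ a n → a + suc n < N → suc a + n < N
  shift-< a n = subst (_< N) (+-suc a n)

  index-< : ∀ a n → a + suc n < N → suc a < N
  index-< a n p = ≤-<-trans (s≤s (m≤m+n a n)) (shift-< a n p)

  build-preserves : ∀ {n h D} {w : Vec ℕ n} a W j → OddFrom h D w → a + n < N → j < suc a →
                    run j (before down 0) (build (suc a) D w W) ≡ run j (before down 0) W
  build-preserves-next : ∀ {n h D} {w : Vec ℕ n} a t l r W j → OddFrom h D w → a + suc n < N → j < suc a →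
                    run j (before down 0) (build (suc a) (r ∷ l ∷ D) (t ∷ w) W) ≡ run j (before down 0) W
  build-preserves-next {n} a t l r W j o aN ja = trans
    (build-preserves (suc a) _ j o (shift-< a n aN) (m<n⇒m<1+n ja))
    (insert-preserves ja (index-< a n aN) t l r _ W)
  build-preserves a W j (down t≤h end)      aN ja = insert-preserves ja (index-< a 0 aN) _ down down _ W
  build-preserves a W j (up   t≤h (up   o)) aN ja = build-preserves-next a _ up   up   W j o aN ja
  build-preserves a W j (up   t≤h (down o)) aN ja = build-preserves-next a _ down up   W j o aN ja
  build-preserves a W j (down t≤h (up   o)) aN ja = build-preserves-next a _ up   down W j o aN ja
  build-preserves a W j (down t≤h (down o)) aN ja = build-preserves-next a _ down down W j o aN ja

  Built : ∀ {n} → ℕ → List Step → Vec ℕ n → List ℕ → Set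
  Built {n} a D w W = (build (suc a) D w W ↭ vals (a + n)) × Reads (build (suc a) D w W) (suc a) D w

  build-next : ∀ {n h h′ D} {w : Vec ℕ n} a t l r W → OddFrom h′ D w → a + suc n < N → t ≤ h → Invariant a h W →
    bit l + bit r + h ≡ suc h′ →
    (Invariant (suc a) h′ (insert (suc a) t l r W) → Built (suc a) D w (insert (suc a) t l r W)) →
    Built a (r ∷ l ∷ D) (t ∷ w) W
  build-next {n} {h} {D = D} {w} a t l r W o aN t≤h I e rec =
      subst (λ z → build (suc (suc a)) D w (insert (suc a) t l r W) ↭ vals z) (sym (+-suc a n)) (proj₁ B)
    , trans (cong finish (build-preserves (suc a) _ (suc a) o (shift-< a n aN) (n<1+n _)))
            (insert-stats aN′ t l r (spread I) (subst (t <_) (sym (ngaps I)) (s≤s t≤h)))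
    ∷ proj₂ B
    where
    aN′ : suc a < N
    aN′ = index-< a n aN
    B = rec (next-invariant aN′ t l r t≤h I e)

  build-correct : ∀ {n h D} {w : Vec ℕ n} a W → OddFrom h D w → a + n < N → Invariant a h W → Built a D w W
  build-correct a W (up p (up o))   aN I = build-next a _ up up W o aN p I refl (build-correct (suc a) _ o (shift-< a _ aN))
  build-correct a W (up p (down o)) aN I = build-next a _ down up W o aN p I refl (build-correct (suc a) _ o (shift-< a _ aN))
  build-correct a W (down p (up o)) aN I = build-next a _ up down W o aN p I refl (build-correct (suc a) _ o (shift-< a _ aN))
  build-correct a W (down p (down o)) aN I = build-next a _ down down W o aN p I refl (build-correct (suc a) _ o (shift-< a _ aN))
  build-correct a W (down z≤n end) aN I = subst (λ z → W′ ↭ vals z) (+-comm 1 a) (subst (λ g → W′ ↭ replicate g N ++ vals (suc a)) g0 p) , final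
    where
    W′ = insert (suc a) 0 down down W
    aN′ : suc a < N
    aN′ = index-< a 0 aN
    t< : 0 < gaps W
    t< = subst (0 <_) (sym (ngaps I)) (s≤s z≤n)
    p = insert-perm aN′ 0 down down (spread I) t< (perm I)
    g0 : gaps W′ ≡ 0
    g0 = suc-injective (trans (insert-gaps aN′ 0 down down W t<) (ngaps I))

tabulate-end : ∀ (g : ℕ → ℕ) n → tabulate {n = suc n} (g ∘ toℕ) ≡ tabulate {n = n} (g ∘ toℕ) ++ g n ∷ []
tabulate-end g zero    = refl
tabulate-end g (suc n) = cong (g 0 ∷_) (tabulate-end (g ∘ suc) n)

tabulate-injective : ∀ {n} {A : Set} (f g : Fin n → A) → tabulate f ≡ tabulate g → ∀ i → f i ≡ g i
tabulate-injective f g e Fin.zero    = ∷-injectiveˡ e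
tabulate-injective f g e (Fin.suc i) = tabulate-injective (f ∘ Fin.suc) (g ∘ Fin.suc) (∷-injectiveʳ e) i

word-injective : ∀ {n} (σ τ : Permutation′ n) → word σ ≡ word τ → σ ≈ τ
word-injective σ τ e i = toℕ-injective (suc-injective (tabulate-injective _ _ e i))

word-cong : ∀ {n} (σ τ : Permutation′ n) → σ ≈ τ → word σ ≡ word τ
word-cong σ τ e = tabulate-cong (λ i → cong ⟦_⟧ (e i))

tabulate-cast : ∀ {n} (F : List ℕ) (e : n ≡ length F) → tabulate (λ i → lookup F (cast e i)) ≡ F
tabulate-cast F refl = trans (tabulate-cong (λ i → cong (lookup F) (cast-is-id refl i))) (tabulate-lookup F)

values : ∀ n → List ℕ
values n = tabulate {n = n} ⟦_⟧

module _ {n} {F : List ℕ} (p : F ↭ values n) where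
  private
    p′ = ↭⇒↭ₛ p
    len-values : length (values n) ≡ n
    len-values = length-tabulate {n = n} ⟦_⟧
    lenF : length F ≡ n
    lenF = trans (↭.↭-length p) len-values

  toPerm : Permutation′ n
  toPerm = cast-id (sym lenF) ∘ₚ (HomogeneousPermutation.onIndices p′ ∘ₚ cast-id len-values)

  word-toPerm : word toPerm ≡ F
  word-toPerm = trans (tabulate-cong lem) (tabulate-cast F (sym lenF))
    where
    lem : ∀ i → ⟦ toPerm ⟨$⟩ʳ i ⟧ ≡ lookup F (cast (sym lenF) i)
    lem i = trans (sym (lookup-tabulate ⟦_⟧ (toPerm ⟨$⟩ʳ i)))
      (trans (cong (lookup (values n)) (cast-involutive (sym len-values) len-values _))
        (sym (↭ₛ.onIndices-lookup (setoid ℕ) p′ (cast (sym lenF) i))))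

once-tabulate : ∀ {n k} (f : Fin n → ℕ) V i → f i ≡ k → (∀ j → f j ≡ k → j ≡ i) → All (_≢ k) V →
                Once k (tabulate f ++ V)
once-tabulate f V Fin.zero refl u a = here (All.++⁺ (All.tabulate⁺ (λ j e → lem (u (Fin.suc j) e))) a)
  where lem : ∀ {m} {j : Fin m} → Fin.suc j ≡ Fin.zero → ⊥
        lem ()
once-tabulate f V (Fin.suc i) e u a = there (λ q → lem (u Fin.zero q))
    (once-tabulate (f ∘ Fin.suc) V i e (λ j q → lem′ (u (Fin.suc j) q)) a)
  where lem : ∀ {m} {j : Fin m} → Fin.zero ≡ Fin.suc j → ⊥
        lem ()
        lem′ : ∀ {m} {j k : Fin m} → Fin.suc j ≡ Fin.suc k → j ≡ k
        lem′ refl = refl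

once-word : ∀ {n} (σ : Permutation′ n) k V → All (_≢ ⟦ k ⟧) V → Once ⟦ k ⟧ (word σ ++ V)
once-word σ k V a = once-tabulate _ V (σ ⟨$⟩ˡ k) (cong ⟦_⟧ (inverseʳ σ))
  (λ j e → trans (sym (inverseˡ σ)) (cong (σ ⟨$⟩ˡ_) (toℕ-injective (suc-injective e)))) a

Stats : ∀ {n} → ℕ → Permutation′ n → Fin n → State
Stats e σ k = after (left-step e σ k) (tot σ k) (right-step e σ k)

after-injective : ∀ {l t r l′ t′ r′} → after l t r ≡ after l′ t′ r′ → (l ≡ l′) × (t ≡ t′) × (r ≡ r′)
after-injective refl = refl , refl , refl

finish-0 : ∀ s {l t r} → trans-st small s ≡ after l t r → finish s ≡ after l t r
finish-0 (before p c)  ()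
finish-0 (at p c)      e = e
finish-0 (after p c r) e = e

finish-word : ∀ {n} (σ : Permutation′ n) k → finish (run ⟦ k ⟧ (before down 0) (word σ)) ≡ Stats 0 σ k
finish-word σ k = finish-0 _ (trans (sym (run-++ ⟦ k ⟧ (before down 0) (word σ) (0 ∷ []))) (run-word σ 0 k))

module _ {n : ℕ} (σ : Permutation′ n) where
  open Insertion (suc n)

  stage-at : ∀ e V k → Once ⟦ k ⟧ V → finish (run ⟦ k ⟧ (before down 0) V) ≡ Stats e σ k →
    let W = collapse ⟦ k ⟧ down V in
    (tot σ k < gaps W) × (EndsN V → right-step e σ k ≡ down → suc (tot σ k) < gaps W) ×
    (insert ⟦ k ⟧ (tot σ k) (left-step e σ k) (right-step e σ k) W ≡ collapse (suc ⟦ k ⟧) down V)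
  stage-at e V k o q with stage (s≤s (toℕ<n k)) down 0 o
  ... | t , l , r , stats , t< , inner , next with after-injective (trans (sym stats) q)
  ...   | refl , refl , refl = t< , inner , next

  gaps-next : ∀ e V k → Once ⟦ k ⟧ V → finish (run ⟦ k ⟧ (before down 0) V) ≡ Stats e σ k →
    suc (gaps (collapse (suc ⟦ k ⟧) down V)) ≡
    bit (left-step e σ k) + bit (right-step e σ k) + gaps (collapse ⟦ k ⟧ down V)
  gaps-next e V k o q with stage-at e V k o q
  ... | t< , _ , next = trans (cong (suc ∘ gaps) (sym next))
    (insert-gaps (s≤s (toℕ<n k)) (tot σ k) (left-step e σ k) (right-step e σ k) (collapse ⟦ k ⟧ down V) t<)

collapse-all-big : ∀ N k V → All (k ≤_) V → Gaps.collapse N k up V ≡ N ∷ []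
collapse-all-big N k [] [] = refl
collapse-all-big N k (x ∷ V) (p ∷ a) = trans (Gaps.collapse-big N up V p) (collapse-all-big N k V a)

collapse-all-big′ : ∀ N k x V → All (k ≤_) (x ∷ V) → Gaps.collapse N k down (x ∷ V) ≡ N ∷ []
collapse-all-big′ N k x V (p ∷ a) = trans (Gaps.collapse-big N down V p) (collapse-all-big N k V a)

collapse-all-small : ∀ N k U V → All (_< k) U → Gaps.collapse N k down (U ++ V) ≡ U ++ Gaps.collapse N k down V
collapse-all-small N k [] V [] = refl
collapse-all-small N k (x ∷ U) V (p ∷ a) = trans (Gaps.collapse-small N down (U ++ V) p) (cong (x ∷_) (collapse-all-small N k U V a))

gaps-all-small : ∀ N U V → All (_< N) U → Gaps.gaps N (U ++ V) ≡ Gaps.gaps N V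
gaps-all-small N [] V [] = refl
gaps-all-small N (x ∷ U) V (p ∷ a) = trans (Gaps.gaps-small N (U ++ V) p) (gaps-all-small N U V a)

word-< : ∀ {n} (σ : Permutation′ n) → All (_< suc n) (word σ)
word-< σ = All.tabulate⁺ (λ i → s≤s (toℕ<n _))

word-≥1 : ∀ {n} (σ : Permutation′ n) → All (1 ≤_) (word σ)
word-≥1 σ = All.tabulate⁺ (λ i → s≤s z≤n)

even-cons : ∀ {n t h g D} {w : Vec ℕ n} r l → t < suc h → (r ≡ down → suc t < suc h) →
            suc g ≡ bit l + bit r + suc h → (∀ h′ → g ≡ suc h′ → EvenFrom h′ D w) →
            EvenFrom h (r ∷ l ∷ D) (t ∷ w)
even-cons up   up   p q e rec = up (up (≤-pred p) (rec _ (suc-injective e)))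
even-cons up   down p q e rec = up (down (≤-pred p) (rec _ (suc-injective e)))
even-cons {h = zero} down l p q e rec with q refl
... | s≤s ()
even-cons {h = suc h} down up   p q e rec = down (up (≤-pred (≤-pred (q refl))) (rec _ (suc-injective e)))
even-cons {h = suc h} down down p q e rec = down (down (≤-pred (≤-pred (q refl))) (rec _ (suc-injective e)))

odd-cons : ∀ {n t h g D} {w : Vec ℕ n} r l → t < suc h → 0 < g →
           suc g ≡ bit l + bit r + suc h → (∀ h′ → g ≡ suc h′ → OddFrom h′ D w) →
           OddFrom h (r ∷ l ∷ D) (t ∷ w)
odd-cons up   up   p q e rec = up (≤-pred p) (up (rec _ (suc-injective e)))
odd-cons up   down p q e rec = up (≤-pred p) (down (rec _ (suc-injective e)))
odd-cons down up   p q e rec = down (≤-pred p) (up (rec _ (suc-injective e)))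
odd-cons {h = zero}  down down p q e rec = ⊥-elim (<-irrefl refl (subst (0 <_) (suc-injective e) q))
odd-cons {h = suc h} down down p q e rec = down (≤-pred p) (down (rec _ (suc-injective e)))

odd-end : ∀ {t l r h} → t < suc h → 1 ≡ bit l + bit r + suc h → (t ≡ 0) × (l ≡ down) × (r ≡ down) × (h ≡ 0)
odd-end {zero} {down} {down} {zero} _ _ = refl , refl , refl , refl
odd-end {l = down} {down} {suc h} _ ()
odd-end {suc t} {down} {down} {zero} (s≤s ()) _
odd-end {l = up} {up} _ ()
odd-end {l = up} {down} _ ()
odd-end {l = down} {up} _ ()

module _ {n : ℕ} (σ : Permutation′ n) where
  open Insertion (suc n)
  private
    V : List ℕ
    V = word σ ++ suc n ∷ []

    once : ∀ k → Once ⟦ k ⟧ V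
    once k = once-word σ k _ ((λ e → <-irrefl (sym e) (s≤s (toℕ<n k))) ∷ [])

    stats : ∀ k → finish (run ⟦ k ⟧ (before down 0) V) ≡ Stats (suc n) σ k
    stats k = cong finish (run-word σ (suc n) k)

    ends : ∀ U → EndsN (U ++ suc n ∷ [])
    ends []      = last
    ends (x ∷ U) = more (ends U)

    first : gaps (collapse 1 down V) ≡ 1
    first = trans (cong gaps (lem V (All.++⁺ (word-≥1 σ) (s≤s z≤n ∷ [])) (word σ) refl)) (gaps-gap [])
      where lem : ∀ V → All (1 ≤_) V → ∀ U → V ≡ U ++ suc n ∷ [] → collapse 1 down V ≡ suc n ∷ []
            lem (x ∷ V) a _ _ = collapse-all-big′ (suc n) 1 x V a
            lem [] a [] ()
            lem [] a (_ ∷ _) ()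

    final-gaps : gaps (collapse (suc n) down V) ≡ 1
    final-gaps = trans (cong gaps (trans (collapse-all-small (suc n) (suc n) (word σ) _ (word-< σ))
        (cong (word σ ++_) (collapse-big {suc n} {suc n} down [] ≤-refl))))
      (trans (gaps-all-small (suc n) (word σ) _ (word-< σ)) (gaps-gap []))

  FV-even : ∀ m a h (f : Fin m → Fin n) → (∀ i → toℕ (f i) ≡ a + toℕ i) → a + m ≡ n →
            gaps (collapse (suc a) down V) ≡ suc h →
            EvenFrom h (concatMap (two-steps (suc n) σ) (tabulate f)) (Vec.tabulate (tot σ ∘ f))
  FV-even zero a h f hf an g = subst (λ h → EvenFrom h [] [])
    (suc-injective (trans (sym (subst (λ z → gaps (collapse (suc z) down V) ≡ 1) (trans (sym an) (+-identityʳ a)) final-gaps)) g)) end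
  FV-even (suc m) a h f hf an g =
    even-cons (right-step (suc n) σ k) (left-step (suc n) σ k)
      (subst (tot σ k <_) g′ (proj₁ S))
      (λ d → subst (suc (tot σ k) <_) g′ (proj₁ (proj₂ S) (ends (word σ)) d))
      (trans (gaps-next σ (suc n) V k (once k) (stats k)) (cong (bit (left-step (suc n) σ k) + bit (right-step (suc n) σ k) +_) g′))
      (λ h′ e → FV-even m (suc a) h′ (f ∘ Fin.suc) (λ i → trans (hf (Fin.suc i)) (+-suc a _)) (trans (sym (+-suc a m)) an)
                  (trans (cong (λ z → gaps (collapse (suc (suc z)) down V)) (sym hk)) e))
    where
    k = f Fin.zero
    hk : toℕ k ≡ a
    hk = trans (hf Fin.zero) (+-identityʳ a)
    g′ : gaps (collapse ⟦ k ⟧ down V) ≡ suc h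
    g′ = trans (cong (λ z → gaps (collapse (suc z) down V)) hk) g
    S = stage-at σ (suc n) V k (once k) (stats k)

  FV-valid : EvenFrom 0 (FV-path σ) (FV-weight σ)
  FV-valid = FV-even n 0 0 (λ k → k) (λ _ → refl) refl first

ψFV : ∀ {n} → Permutation′ n → WeightedDyckPath n
ψFV σ = toWDP (FV-valid σ)

module _ {m : ℕ} (σ : Permutation′ (suc m)) where
  open Insertion (suc (suc m))
  private
    V : List ℕ
    V = word σ

    once : ∀ k → Once ⟦ k ⟧ V
    once k = subst (Once ⟦ k ⟧) (++-identityʳ V) (once-word σ k [] [])

    first : collapse 1 down V ≡ suc (suc m) ∷ []
    first = collapse-all-big′ (suc (suc m)) 1 _ _ (word-≥1 σ)

    final-word : collapse (suc (suc m)) down V ≡ V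
    final-word = trans (cong (collapse (suc (suc m)) down) (sym (++-identityʳ V)))
      (trans (collapse-all-small (suc (suc m)) (suc (suc m)) V [] (word-< σ)) (++-identityʳ V))

    final-gaps : gaps (collapse (suc (suc m)) down V) ≡ 0
    final-gaps = trans (cong gaps (trans final-word (sym (++-identityʳ V)))) (gaps-all-small (suc (suc m)) V [] (word-< σ))

  gaps-pos : ∀ a → a < suc m → 0 < gaps (collapse (suc a) down V)
  gaps-pos a p = subst (λ z → 0 < gaps (collapse (suc z) down V)) (toℕ-fromℕ< p)
    (≤-<-trans z≤n (proj₁ (stage-at σ 0 V (fromℕ< p) (once _) (finish-word σ _))))

  FV⁰-odd : ∀ m′ a h (f : Fin m′ → Fin (suc m)) → (∀ i → toℕ (f i) ≡ a + toℕ i) → a + m′ ≡ m →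
            gaps (collapse (suc a) down V) ≡ suc h →
            let D = concatMap (two-steps 0 σ) (tabulate f) ++ down ∷ []
                w = Vec.tabulate (tot σ ∘ f) Vec.∷ʳ 0
            in OddFrom h D w × (build (suc a) D w (collapse (suc a) down V) ≡ V)
  FV⁰-odd zero a h f hf am g = subst (λ h → OddFrom h (down ∷ []) (0 ∷ [])) (sym h0) (down z≤n end) ,
    trans (cong₂ (λ z W → insert z 0 down down W) (cong suc (sym hk)) (cong (λ z → collapse (suc z) down V) (sym hk)))
    (trans (ins t0 l0 r0) (trans (proj₂ (proj₂ S)) (trans (cong (λ z → collapse (suc (suc z)) down V) (toℕ-fromℕ m)) final-word)))
    where
    k = fromℕ m
    hk : toℕ k ≡ a
    hk = trans (toℕ-fromℕ m) (trans (sym am) (+-identityʳ a))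
    g′ : gaps (collapse ⟦ k ⟧ down V) ≡ suc h
    g′ = trans (cong (λ z → gaps (collapse (suc z) down V)) hk) g
    S = stage-at σ 0 V k (once k) (finish-word σ k)
    e : 1 ≡ bit (left-step 0 σ k) + bit (right-step 0 σ k) + suc h
    e = trans (cong suc (sym (trans (cong (λ z → gaps (collapse (suc (suc z)) down V)) (toℕ-fromℕ m)) final-gaps)))
          (trans (gaps-next σ 0 V k (once k) (finish-word σ k)) (cong (bit (left-step 0 σ k) + bit (right-step 0 σ k) +_) g′))
    E = odd-end {tot σ k} {left-step 0 σ k} {right-step 0 σ k} {h} (subst (tot σ k <_) g′ (proj₁ S)) e
    t0 = proj₁ E
    l0 = proj₁ (proj₂ E)
    r0 = proj₁ (proj₂ (proj₂ E))
    h0 = proj₂ (proj₂ (proj₂ E))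
    ins : ∀ {t l r} → t ≡ 0 → l ≡ down → r ≡ down →
          insert ⟦ k ⟧ 0 down down (collapse ⟦ k ⟧ down V) ≡ insert ⟦ k ⟧ t l r (collapse ⟦ k ⟧ down V)
    ins refl refl refl = refl
  FV⁰-odd (suc m′) a h f hf am g =
      odd-cons (right-step 0 σ k) (left-step 0 σ k) (subst (tot σ k <_) g′ (proj₁ S)) pos-next
        (trans (gaps-next σ 0 V k (once k) (finish-word σ k)) (cong (bit (left-step 0 σ k) + bit (right-step 0 σ k) +_) g′))
        (λ h′ e → proj₁ (rec h′ (trans (cong (λ z → gaps (collapse (suc (suc z)) down V)) (sym hk)) e)))
    , trans (cong (build (suc (suc a)) D w)
             (trans (cong₂ (λ z W → insert z (tot σ k) (left-step 0 σ k) (right-step 0 σ k) W) (cong suc (sym hk))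
                       (cong (λ z → collapse (suc z) down V) (sym hk)))
               (trans (proj₂ (proj₂ S)) (cong (λ z → collapse (suc (suc z)) down V) hk))))
        (proj₂ (rec (pred (gaps (collapse (suc (suc a)) down V))) (sym (suc-pred′ (gaps-pos (suc a) a<)))))
    where
    k = f Fin.zero
    D = concatMap (two-steps 0 σ) (tabulate (f ∘ Fin.suc)) ++ down ∷ []
    w = Vec.tabulate (tot σ ∘ f ∘ Fin.suc) Vec.∷ʳ 0
    hk : toℕ k ≡ a
    hk = trans (hf Fin.zero) (+-identityʳ a)
    g′ : gaps (collapse ⟦ k ⟧ down V) ≡ suc h
    g′ = trans (cong (λ z → gaps (collapse (suc z) down V)) hk) g
    S = stage-at σ 0 V k (once k) (finish-word σ k)
    am′ : suc a + m′ ≡ m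
    am′ = trans (sym (+-suc a m′)) am
    a< : suc a < suc m
    a< = s≤s (subst (suc a ≤_) am′ (m≤m+n (suc a) m′))
    rec = λ h′ → FV⁰-odd m′ (suc a) h′ (f ∘ Fin.suc) (λ i → trans (hf (Fin.suc i)) (+-suc a _)) am′
    pos-next : 0 < gaps (collapse (suc ⟦ k ⟧) down V)
    pos-next = subst (λ z → 0 < gaps (collapse (suc (suc z)) down V)) (sym hk) (gaps-pos (suc a) a<)
    suc-pred′ : ∀ {x} → 0 < x → suc (pred x) ≡ x
    suc-pred′ (s≤s _) = refl

  private
    D₀ : List Step
    D₀ = concatMap (two-steps 0 σ) (tabulate inject₁) ++ down ∷ []

    valid-and-built : OddFrom 0 D₀ (FV⁰-weight σ) × (build 1 D₀ (FV⁰-weight σ) (collapse 1 down V) ≡ V)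
    valid-and-built = FV⁰-odd m 0 0 inject₁ toℕ-inject₁ refl (trans (cong gaps first) (gaps-gap []))

  FV⁰-valid : EvenFrom 0 (FV⁰-path σ) (FV⁰-weight σ)
  FV⁰-valid = up (proj₁ valid-and-built)

  FV⁰-built : build 1 D₀ (FV⁰-weight σ) (suc (suc m) ∷ []) ≡ word σ
  FV⁰-built = trans (cong (build 1 D₀ (FV⁰-weight σ)) (sym first)) (proj₂ valid-and-built)

ascending : ∀ n → let open Insertion n in vals n ↭ values n
ascending n = go n
  where
  open Insertion n
  go : ∀ n → vals n ↭ values n
  go zero    = ↭-refl
  go (suc n) = ↭-trans (↭-prep (suc n) (go n)) (↭-trans (↭.++-comm (suc n ∷ []) (values n))
                 (↭-reflexive (sym (tabulate-end suc n))))

ψ⁰FV : ∀ {m} → Permutation′ (suc m) → WeightedDyckPath (suc m)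
ψ⁰FV σ = toWDP (FV⁰-valid σ)

Perm-setoid : ℕ → Setoid _ _
Perm-setoid n = record
  { Carrier       = Permutation′ n
  ; _≈_           = _≈_
  ; isEquivalence = record { refl  = λ i → refl
                           ; sym   = λ e i → sym (e i)
                           ; trans = λ e e′ i → trans (e i) (e′ i) } }

-- Weighted Dyck paths are compared by their underlying data (D , w).
WDP-setoid : ℕ → Setoid _ _
WDP-setoid n = On.setoid (setoid (List Step × Vec ℕ n)) (λ d → path d , weight d)

odd-tail : ∀ {m D} {w : Vec ℕ (suc m)} → EvenFrom 0 D w → OddFrom 0 (drop 1 D) w
odd-tail (up o) = o

head-up : ∀ {m D} {w : Vec ℕ (suc m)} → EvenFrom 0 D w → up ∷ drop 1 D ≡ D
head-up (up o) = refl

module _ {m : ℕ} where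
  open Insertion (suc (suc m))

  decode : List Step → Vec ℕ (suc m) → List ℕ
  decode D w = build 1 (drop 1 D) w (suc (suc m) ∷ [])

  initial : Invariant 0 0 (suc (suc m) ∷ [])
  initial = record { ngaps = gaps-gap [] ; spread = hole []
                   ; perm = ↭-reflexive (cong (λ g → replicate g (suc (suc m)) ++ []) (sym (gaps-gap []))) }

  decoded : (d : WeightedDyckPath (suc m)) → Built 0 (drop 1 (path d)) (weight d) (suc (suc m) ∷ [])
  decoded d = build-correct 0 _ (odd-tail (fromWDP d)) ≤-refl initial

  decoded-↭ : (d : WeightedDyckPath (suc m)) → decode (path d) (weight d) ↭ values (suc m)
  decoded-↭ d = ↭-trans (proj₁ (decoded d)) (ascending (suc m))

  ψ⁰FV⁻¹ : WeightedDyckPath (suc m) → Permutation′ (suc m)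
  ψ⁰FV⁻¹ d = toPerm (decoded-↭ d)

  word-ψ⁰FV⁻¹ : ∀ (d : WeightedDyckPath (suc m)) → word (ψ⁰FV⁻¹ d) ≡ decode (path d) (weight d)
  word-ψ⁰FV⁻¹ d = word-toPerm (decoded-↭ d)

  reads-data : ∀ {m′ D} {w : Vec ℕ (suc m′)} (σ : Permutation′ (suc m)) a (f : Fin m′ → Fin (suc m)) →
    (∀ i → toℕ (f i) ≡ a + toℕ i) → Reads (word σ) (suc a) D w →
    (concatMap (two-steps 0 σ) (tabulate f) ++ down ∷ [] ≡ D) × (Vec.tabulate (tot σ ∘ f) Vec.∷ʳ 0 ≡ w)
  reads-data {zero} σ a f hf final = refl , refl
  reads-data {suc m′} σ a f hf (e ∷ R)
    with after-injective (trans (sym (finish-word σ (f Fin.zero)))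
           (trans (cong (λ z → finish (run (suc z) (before down 0) (word σ))) (trans (hf Fin.zero) (+-identityʳ a))) e))
       | reads-data σ (suc a) (f ∘ Fin.suc) (λ i → trans (hf (Fin.suc i)) (+-suc a _)) R
  ... | l , t , r | D , w = cong₂ _∷_ r (cong₂ _∷_ l D) , cong₂ _∷_ t w

  ψ⁰FV-ψ⁰FV⁻¹ : ∀ (d : WeightedDyckPath (suc m)) → (path (ψ⁰FV (ψ⁰FV⁻¹ d)) ≡ path d) × (weight (ψ⁰FV (ψ⁰FV⁻¹ d)) ≡ weight d)
  ψ⁰FV-ψ⁰FV⁻¹ d = trans (cong (up ∷_) (proj₁ R)) (head-up (fromWDP d)) , proj₂ R
    where
    R = reads-data (ψ⁰FV⁻¹ d) 0 inject₁ toℕ-inject₁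
          (subst (λ W → Reads W 1 (drop 1 (path d)) (weight d)) (sym (word-ψ⁰FV⁻¹ d)) (proj₂ (decoded d)))

  ψ⁰FV⁻¹-ψ⁰FV : ∀ (σ : Permutation′ (suc m)) → ψ⁰FV⁻¹ (ψ⁰FV σ) ≈ σ
  ψ⁰FV⁻¹-ψ⁰FV σ = word-injective (ψ⁰FV⁻¹ (ψ⁰FV σ)) σ (trans (word-ψ⁰FV⁻¹ (ψ⁰FV σ)) (FV⁰-built σ))

  ψ⁰FV⁻¹-cong : ∀ (d d′ : WeightedDyckPath (suc m)) → (path d , weight d) ≡ (path d′ , weight d′) → ψ⁰FV⁻¹ d ≈ ψ⁰FV⁻¹ d′
  ψ⁰FV⁻¹-cong d d′ e = word-injective (ψ⁰FV⁻¹ d) (ψ⁰FV⁻¹ d′) (trans (word-ψ⁰FV⁻¹ d)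
    (trans (cong (λ (D , w) → decode D w) e) (sym (word-ψ⁰FV⁻¹ d′))))

  ψ⁰FV-cong : ∀ (σ τ : Permutation′ (suc m)) → σ ≈ τ → (FV⁰-path σ , FV⁰-weight σ) ≡ (FV⁰-path τ , FV⁰-weight τ)
  ψ⁰FV-cong σ τ e = cong₂ _,_
    (cong (λ D → up ∷ D ++ down ∷ [])
      (concatMap-cong (λ k → cong₂ (λ r l → r ∷ l ∷ []) (proj₂ (proj₂ (same k))) (proj₁ (same k))) (tabulate inject₁)))
    (cong (Vec._∷ʳ 0) (Vec.tabulate-cong (λ k → proj₁ (proj₂ (same (inject₁ k))))))
    where
    same : ∀ (k : Fin (suc m)) → (left-step 0 σ k ≡ left-step 0 τ k) × (tot σ k ≡ tot τ k) × (right-step 0 σ k ≡ right-step 0 τ k)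
    same k = after-injective (trans (sym (finish-word σ k))
      (trans (cong (λ W → finish (run ⟦ k ⟧ (before down 0) W)) (word-cong σ τ e)) (finish-word τ k)))

ψ⁰FV-bijection : ∀ m → Inverse (Perm-setoid (suc m)) (WDP-setoid (suc m))
ψ⁰FV-bijection m = record
  { to        = ψ⁰FV
  ; from      = ψ⁰FV⁻¹
  ; to-cong   = λ {σ} {τ} → ψ⁰FV-cong σ τ
  ; from-cong = λ {d} {d′} → ψ⁰FV⁻¹-cong d d′
  ; inverse   = (λ {d} {σ} e → trans (ψ⁰FV-cong σ (ψ⁰FV⁻¹ d) e) (cong₂ _,_ (proj₁ (ψ⁰FV-ψ⁰FV⁻¹ d)) (proj₂ (ψ⁰FV-ψ⁰FV⁻¹ d))))
              , (λ {σ} {d} e i → trans (ψ⁰FV⁻¹-cong d (ψ⁰FV σ) e i) (ψ⁰FV⁻¹-ψ⁰FV σ i)) }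

-- Inverse.from is the two-sided inverse of ψ⁰FV given by the insertion algorithm.
Ψ : ∀ {m} → Permutation′ (suc m) → Permutation′ (suc m)
Ψ {m} σ = Inverse.from (ψ⁰FV-bijection m) (ψ (ψFV σ))

{-# OPTIONS --safe #-}

-- ψ exchanges the two steps of every pair D₂ᵢD₂ᵢ₊₁, equal or not.  Hence a value k < n has the
-- same left step and the same weight for σ and for Ψ σ; only the right steps differ.  When k is
-- inserted, its right step influences nothing but the number of gaps on the right of k, so for
-- each gap the largest letter on its left depends on left steps and weights only.  Therefore
-- so does the largest j < k standing on the left of k, and these numbers determine the tree:
-- the root of {lo,…,hi} is its largest element k with no element of {lo,…,k - 1} on its left.
module Submission where

open import Data.Bool using (Bool; true; false; if_then_else_)
open import Data.Empty using (⊥-elim)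
open import Data.Fin as Fin using (Fin; fromℕ; inject₁)
open import Data.Fin.Induction using (<-weakInduction)
open import Data.Fin.Permutation using (Permutation′; _⟨$⟩ʳ_; _⟨$⟩ˡ_; inverseʳ)
open import Data.Fin.Properties using (toℕ<n; toℕ-inject₁; toℕ-fromℕ)
open import Data.Fin.Relation.Unary.Top using (view; ‵fromℕ; ‵inject₁)
open import Data.List using (List; []; _∷_; _++_; find; length; concatMap; tabulate)
open import Data.List.Membership.Propositional using (_∈_)
open import Data.List.Membership.Propositional.Properties using (∈-tabulate⁺; ∈-tabulate⁻)
open import Data.List.Properties using (++-identityʳ; filter-none; ∷-injectiveˡ; ∷-injectiveʳ)
open import Data.List.Relation.Unary.All as All using (All; []; _∷_)
import Data.List.Relation.Unary.All.Properties as All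
open import Data.List.Relation.Unary.Any using (here; there)
open import Data.Maybe using (just; nothing)
open import Data.Nat using (ℕ; zero; suc; _∸_; _≤_; _<_; _≤?_; _<?_; _⊔_; z≤n; s≤s)
open import Data.Nat.Properties using
  ( ≤-refl; ≤-trans; ≤-<-trans; <-≤-trans; <⇒≤; <⇒≱; <-irrefl; ≤-antisym; ≰⇒>; ≮⇒≥; ⊔-lub; ⊔-pres-<m
  ; m≤m⊔n; m≤n⊔m; m≥n⇒m⊔n≡m; m≤n⇒m⊔n≡n)
open import Data.Product using (_×_; _,_; proj₁; proj₂)
open import Data.Vec as Vec using ()
import Data.Vec.Properties as Vec
open import Function using (_∘_; id)
open import Relation.Binary.PropositionalEquality
  using (_≡_; refl; sym; trans; cong; cong₂; subst)
open import Relation.Nullary using (¬_; yes; no)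
open import Relation.Nullary.Decidable using (_×-dec_)
open import Relation.Unary using (Decidable)
open import Defs

-- Search trees from the largest smaller letter on the left of each letter.

maxBelow : ℕ → List ℕ → ℕ
maxBelow k []      = 0
maxBelow k (x ∷ W) with cls k x
... | small = x ⊔ maxBelow k W
... | eq    = 0
... | big   = maxBelow k W

data FirstWith (P : ℕ → Set) (k : ℕ) : List ℕ → Set where
  here  : ∀ {W} → P k → FirstWith P k (k ∷ W)
  there : ∀ {x W} → ¬ P x → FirstWith P k W → FirstWith P k (x ∷ W)

module _ {P : ℕ → Set} (P? : Decidable P) where

  find-just : ∀ W {k} → find P? W ≡ just k → FirstWith P k W
  find-just (x ∷ W) e with P? x
  find-just (x ∷ W) refl | yes p = here p
  ... | no ¬p = there ¬p (find-just W e)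

  find-nothing : ∀ W → find P? W ≡ nothing → All (¬_ ∘ P) W
  find-nothing []      e = []
  find-nothing (x ∷ W) e with P? x
  find-nothing (x ∷ W) () | yes _
  ... | no ¬p = ¬p ∷ find-nothing W e

first-satisfies : ∀ {P k W} → FirstWith P k W → P k
first-satisfies (here p)    = p
first-satisfies (there _ r) = first-satisfies r

first-∈ : ∀ {P k W} → FirstWith P k W → k ∈ W
first-∈ (here _)    = here refl
first-∈ (there _ r) = there (first-∈ r)

Within : ℕ → ℕ → ℕ → Set
Within lo hi v = (lo ≤ v) × (v ≤ hi)

maxBelow-∷-≤ : ∀ k {x} W → ¬ x ≡ k → maxBelow k W ≤ maxBelow k (x ∷ W)
maxBelow-∷-≤ k {x} W x≢k with cls k x in e
... | small = m≤n⊔m x _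
... | eq    = ⊥-elim (x≢k (cls-eq k x e))
... | big   = ≤-refl

-- Letters before the root lie outside the interval, and those smaller than `k` are at most `hi`, so
-- they are below `lo`. The bound `1 ≤ lo` covers the value 0 of an empty maximum.
maxBelow-root : ∀ {lo hi k W} → 1 ≤ lo → FirstWith (Within lo hi) k W → maxBelow k W < lo
maxBelow-root {k = k} 1≤lo (here _) rewrite cls-refl k = 1≤lo
maxBelow-root {lo} {hi} {k} 1≤lo (there {x} ∉ r) with cls k x in e
... | small = ⊔-pres-<m (≰⇒> (λ lo≤x → ∉ (lo≤x , x≤hi))) (maxBelow-root 1≤lo r)
  where x≤hi = ≤-trans (<⇒≤ (cls-small k x e)) (proj₂ (first-satisfies r))
... | eq    = ≤-<-trans z≤n 1≤lo
... | big   = maxBelow-root 1≤lo r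

-- No letter before the root lies in the interval, so the scan for `j` does not stop before it
-- counts `k`.
root-≤-maxBelow : ∀ {lo hi k j W} → k < j → j ≤ hi → FirstWith (Within lo hi) k W → k ≤ maxBelow j W
root-≤-maxBelow k<j j≤hi (here _) rewrite cls-< k<j = m≤m⊔n _ _
root-≤-maxBelow {k = k} {j} k<j j≤hi (there {W = W} ∉ r) =
  ≤-trans (root-≤-maxBelow k<j j≤hi r) (maxBelow-∷-≤ j W
    λ { refl → ∉ (≤-trans (proj₁ (first-satisfies r)) (<⇒≤ k<j) , j≤hi) })

Agree : List ℕ → List ℕ → Set
Agree U V = ∀ {v} → v ∈ U → (v ∈ V) × (maxBelow v U ≡ maxBelow v V)

-- If `k < j`, then `k` contributes to `maxBelow j U`, which is thus at least `lo`; but `j` is the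
-- root for `V`, where its value is below `lo`.
roots-≤ : ∀ {lo hi j k U V} → Agree V U → 1 ≤ lo →
          FirstWith (Within lo hi) k U → FirstWith (Within lo hi) j V → j ≤ k
roots-≤ {j = j} A 1≤lo rU rV = ≮⇒≥ λ k<j → <⇒≱ (maxBelow-root 1≤lo rV)
  (≤-trans (proj₁ (first-satisfies rU))
    (subst (_ ≤_) (sym (proj₂ (A (first-∈ rV)))) (root-≤-maxBelow k<j (proj₂ (first-satisfies rV)) rU)))

-- Agreement concerns whole words, not intervals, so it passes unchanged to both subtrees once the
-- roots coincide.
bst-agree : ∀ {U V} → Agree U V → Agree V U → ∀ f lo hi → 1 ≤ lo → bst f lo hi U ≡ bst f lo hi V
bst-agree A B zero lo hi 1≤lo = refl
bst-agree {U} {V} A B (suc f) lo hi 1≤lo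
  with find (λ v → (lo ≤? v) ×-dec (v ≤? hi)) U in p | find (λ v → (lo ≤? v) ×-dec (v ≤? hi)) V in q
... | nothing | nothing = refl
... | nothing | just j  = ⊥-elim (All.lookup (find-nothing _ U p) (proj₁ (B (first-∈ r))) (first-satisfies r))
  where r = find-just _ V q
... | just k  | nothing = ⊥-elim (All.lookup (find-nothing _ V q) (proj₁ (A (first-∈ r))) (first-satisfies r))
  where r = find-just _ U p
... | just k  | just j
  with ≤-antisym (roots-≤ A 1≤lo (find-just _ V q) (find-just _ U p)) (roots-≤ B 1≤lo (find-just _ U p) (find-just _ V q))
... | refl = cong₂ (λ L R → node L k R) (bst-agree A B f lo (k ∸ 1) 1≤lo) (bst-agree A B f (suc k) hi (s≤s z≤n))

-- Effect of an insertion on the largest letter left of each gap.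

-- Whether gap i, after an insertion in gap t with left step l, lies on the left of the new letter.
untouched : ℕ → Step → ℕ → Bool
untouched zero    up   zero    = true
untouched zero    down zero    = false
untouched zero    l    (suc i) = false
untouched (suc t) l    zero    = true
untouched (suc t) l    (suc i) = untouched t l i

module MaxLeftOfGap (N : ℕ) where
  open Insertion N

  -- Gaps are numbered from 0; a word with at most i gaps is read to its end.
  maxLeftOfGap : ℕ → List ℕ → ℕ
  maxLeftOfGap i []      = 0
  maxLeftOfGap i (x ∷ W) with small? N x
  maxLeftOfGap i       (x ∷ W) | true  = x ⊔ maxLeftOfGap i W
  maxLeftOfGap zero    (x ∷ W) | false = 0
  maxLeftOfGap (suc i) (x ∷ W) | false = maxLeftOfGap i W

  -- The premise `x < N` exempts the gaps, which are entries `N`.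
  LettersBelow : ℕ → List ℕ → Set
  LettersBelow k = All (λ x → x < N → x < k)

  maxLeftOfGap-≤ : ∀ {k} i W → LettersBelow k W → maxLeftOfGap i W ≤ k
  maxLeftOfGap-≤ i []      []      = z≤n
  maxLeftOfGap-≤ i (x ∷ W) (b ∷ a) with small? N x in e
  maxLeftOfGap-≤ i       (x ∷ W) (b ∷ a) | true  = ⊔-lub (<⇒≤ (b (<-small N x e))) (maxLeftOfGap-≤ i W a)
  maxLeftOfGap-≤ zero    (x ∷ W) (b ∷ a) | false = z≤n
  maxLeftOfGap-≤ (suc i) (x ∷ W) (b ∷ a) | false = maxLeftOfGap-≤ i W a

  gap-below : ∀ {k} r → LettersBelow k (gap r)
  gap-below up   = (λ N<N → ⊥-elim (<-irrefl refl N<N)) ∷ []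
  gap-below down = []

  -- The new letter `k` exceeds all genuine letters, hence is the maximum wherever the scan stops
  -- after it. This is where the right step `r` drops out.
  maxLeftOfGap-new : ∀ {k} → k < N → ∀ r i W → LettersBelow k W → maxLeftOfGap i (k ∷ gap r ++ W) ≡ k
  maxLeftOfGap-new kN r i W a rewrite small-< kN =
    m≥n⇒m⊔n≡m (maxLeftOfGap-≤ i (gap r ++ W) (All.++⁺ (gap-below r) a))

  -- Gaps left of `k` keep their number and the letters before them; a scan that passes `k` yields
  -- `k`, however the later gaps are renumbered.
  maxLeftOfGap-insert : ∀ {k} → k < N → ∀ t l r i W → LettersBelow k W → t < gaps W →
    maxLeftOfGap i (insert k t l r W) ≡ (if untouched t l i then maxLeftOfGap i W else k)
  maxLeftOfGap-insert {k} kN t l r i (x ∷ W) (b ∷ a) t< with small? N x in e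
  ... | true rewrite e | maxLeftOfGap-insert kN t l r i W a t< with untouched t l i
  ...   | true  = refl
  ...   | false = m≤n⇒m⊔n≡n (<⇒≤ (b (<-small N x e)))
  maxLeftOfGap-insert kN zero up   r zero    (x ∷ W) (b ∷ a) t< | false rewrite small?-N = refl
  -- With `l = up` the gap kept in front of `k` consumes one index; with `l = down` none is consumed
  -- before `k`.
  maxLeftOfGap-insert kN zero up   r (suc i) (x ∷ W) (b ∷ a) t< | false rewrite small?-N = maxLeftOfGap-new kN r i W a
  maxLeftOfGap-insert kN zero down r zero    (x ∷ W) (b ∷ a) t< | false = maxLeftOfGap-new kN r 0 W a
  maxLeftOfGap-insert kN zero down r (suc i) (x ∷ W) (b ∷ a) t< | false = maxLeftOfGap-new kN r (suc i) W a
  maxLeftOfGap-insert kN (suc t) l r zero    (x ∷ W) (b ∷ a) t<       | false rewrite e = refl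
  maxLeftOfGap-insert kN (suc t) l r (suc i) (x ∷ W) (b ∷ a) (s≤s t<) | false rewrite e =
    maxLeftOfGap-insert kN t l r i W a t<

  -- Up to gap `t`, both scans skip the gaps, which exceed `k`, and take the maximum of the genuine
  -- letters, which are below `k`.
  maxBelow-insert : ∀ {k} → k < N → ∀ t l r W → LettersBelow k W → t < gaps W →
    maxBelow k (insert k t l r W) ≡ maxLeftOfGap t W
  maxBelow-insert {k} kN t l r (x ∷ W) (b ∷ a) t< with small? N x in e
  ... | true rewrite cls-< (b (<-small N x e)) = cong (x ⊔_) (maxBelow-insert kN t l r W a t<)
  maxBelow-insert {k} kN zero l r (x ∷ W) (b ∷ a) t< | false = left l
    where
    left : ∀ l → maxBelow k (gap l ++ k ∷ gap r ++ W) ≡ 0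
    left up   rewrite cls-> kN | cls-refl k = refl
    left down rewrite cls-refl k = refl
  maxBelow-insert {k} kN (suc t) l r (x ∷ W) (b ∷ a) (s≤s t<) | false
    rewrite cls-> (<-≤-trans kN (≥-small N x e)) = maxBelow-insert kN t l r W a t<

  collapse-below : ∀ k p W → LettersBelow k (collapse k p W)
  collapse-below k p []      = gap-below p
  collapse-below k p (x ∷ W) with small? k x in e
  ... | true  = All.++⁺ (gap-below p) ((λ _ → <-small k x e) ∷ collapse-below k down W)
  ... | false = collapse-below k up W

  maxBelow-gap-++ : ∀ {k} → k < N → ∀ p W → maxBelow k (gap p ++ W) ≡ maxBelow k W
  maxBelow-gap-++ kN up   W rewrite cls-> kN = refl
  maxBelow-gap-++ kN down W = refl

  -- Collapsing at `suc k` replaces only letters above `k`, and `maxBelow k` skips these as well as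
  -- the gaps.
  maxBelow-collapse : ∀ {k} → k < N → ∀ p W → maxBelow k (collapse (suc k) p W) ≡ maxBelow k W
  maxBelow-collapse {k} kN p [] = subst (λ G → maxBelow k G ≡ 0) (++[] p) (maxBelow-gap-++ kN p [])
    where
    ++[] : ∀ p → gap p ++ [] ≡ gap p
    ++[] up   = refl
    ++[] down = refl
  maxBelow-collapse {k} kN p (x ∷ W) with small? (suc k) x in e
  ... | true = trans (maxBelow-gap-++ kN p _) step
    where
    step : maxBelow k (x ∷ collapse (suc k) down W) ≡ maxBelow k (x ∷ W)
    step with cls k x
    ... | small = cong (x ⊔_) (maxBelow-collapse kN down W)
    ... | eq    = refl
    ... | big   = maxBelow-collapse kN down W
  ... | false rewrite cls-> (≥-small (suc k) x e) = maxBelow-collapse kN up W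

-- Stages of the insertion for the word of a permutation.

module _ {n : ℕ} (σ : Permutation′ n) where

  letter-≤ : ∀ i → letter 0 σ i ≤ n
  letter-≤ zero    = z≤n
  letter-≤ (suc i) with i <? n
  ... | yes _ = toℕ<n _
  ... | no _  = z≤n

  -- The left neighbour has position at most n - 1, so it is never the letter `e` at position n + 1.
  left-step-indep : ∀ e k → left-step e σ k ≡ left-step 0 σ k
  left-step-indep e k = cong (lside ⟦ k ⟧) (letter-indep σ e (pos σ k ∸ 1) (<⇒≤ (toℕ<n (σ ⟨$⟩ˡ k))))

  once-in-word : ∀ k → Once ⟦ k ⟧ (word σ)
  once-in-word k = subst (Once ⟦ k ⟧) (++-identityʳ _) (once-word σ k [] [])

-- No letter exceeds the largest value. This supplies the one weight that `SameLeft` leaves out.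
tot-max : ∀ {m} (σ : Permutation′ (suc m)) → tot σ (fromℕ m) ≡ 0
tot-max {m} σ = cong length (filter-none
  (λ i → (suc i <? pos σ k) ×-dec ((letter 0 σ (suc i) <? ⟦ k ⟧) ×-dec (⟦ k ⟧ <? letter 0 σ i)))
  (All.applyUpTo⁺₂ suc (suc m) λ i (_ , _ , k<) →
    <⇒≱ k< (subst (letter 0 σ (suc i) ≤_) (cong suc (sym (toℕ-fromℕ m))) (letter-≤ σ (suc i)))))
  where k = fromℕ m

module _ {n : ℕ} (σ : Permutation′ n) (k : Fin n) where
  open Insertion (suc n)
  open MaxLeftOfGap (suc n)
  private
    W = collapse ⟦ k ⟧ down (word σ)
    S = stage-at σ 0 (word σ) k (once-in-word σ k) (finish-word σ k)
    k<N : ⟦ k ⟧ < suc n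
    k<N = s≤s (toℕ<n k)

  -- Inserting `k` leads from one stage to the next, which gives a recursion involving only the
  -- weight and the left step of `k`.
  maxLeftOfGap-step : ∀ i → maxLeftOfGap i (collapse (suc ⟦ k ⟧) down (word σ)) ≡
    (if untouched (tot σ k) (left-step 0 σ k) i then maxLeftOfGap i W else ⟦ k ⟧)
  maxLeftOfGap-step i = trans (cong (maxLeftOfGap i) (sym (proj₂ (proj₂ S))))
    (maxLeftOfGap-insert k<N _ _ _ i W (collapse-below ⟦ k ⟧ down (word σ)) (proj₁ S))

  -- Collapsing at `suc k` keeps `maxBelow` and exhibits `k` as the letter just inserted.
  maxBelow-word : maxBelow ⟦ k ⟧ (word σ) ≡ maxLeftOfGap (tot σ k) W
  maxBelow-word = trans (sym (maxBelow-collapse k<N down (word σ)))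
    (trans (cong (maxBelow ⟦ k ⟧) (sym (proj₂ (proj₂ S))))
      (maxBelow-insert k<N _ _ _ W (collapse-below ⟦ k ⟧ down (word σ)) (proj₁ S)))

-- Permutations with the same left steps and weights.

SameLeft : ∀ {m} → Permutation′ (suc m) → Permutation′ (suc m) → Set
SameLeft {m} σ τ = ∀ (i : Fin m) →
  (left-step 0 σ (inject₁ i) ≡ left-step 0 τ (inject₁ i)) × (tot σ (inject₁ i) ≡ tot τ (inject₁ i))

module _ {m : ℕ} (σ τ : Permutation′ (suc m)) (same : SameLeft σ τ) where
  open Insertion (suc (suc m))
  open MaxLeftOfGap (suc (suc m))

  SameGaps : ℕ → Set
  SameGaps a = ∀ i → maxLeftOfGap i (collapse a down (word σ)) ≡ maxLeftOfGap i (collapse a down (word τ))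

  -- Induction on `k` from a single gap. Reaching the stage of `k` takes only the insertions of
  -- smaller values, whose data `same` compares.
  maxLeftOfGap-same : ∀ k → SameGaps ⟦ k ⟧
  maxLeftOfGap-same = <-weakInduction (SameGaps ∘ ⟦_⟧)
    (λ i → cong (maxLeftOfGap i) (trans (one-gap σ) (sym (one-gap τ))))
    λ j IH → subst (SameGaps ∘ suc ∘ suc) (toℕ-inject₁ j) (next j IH)
    where
    one-gap : ∀ ρ → collapse 1 down (word ρ) ≡ suc (suc m) ∷ []
    one-gap ρ = collapse-all-big′ (suc (suc m)) 1 _ _ (word-≥1 ρ)
    next : ∀ j → SameGaps ⟦ inject₁ j ⟧ → SameGaps (suc ⟦ inject₁ j ⟧)
    next j IH i = trans (maxLeftOfGap-step σ k i)
      (trans (cong₂ (λ t l → if untouched t l i then maxLeftOfGap i (collapse ⟦ k ⟧ down (word σ)) else ⟦ k ⟧)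
               (proj₂ (same j)) (proj₁ (same j)))
        (trans (cong (λ x → if untouched (tot τ k) (left-step 0 τ k) i then x else ⟦ k ⟧) (IH i))
          (sym (maxLeftOfGap-step τ k i))))
      where k = inject₁ j

  tot-same : ∀ k → tot σ k ≡ tot τ k
  tot-same k with view k
  ... | ‵fromℕ     = trans (tot-max σ) (sym (tot-max τ))
  ... | ‵inject₁ i = proj₂ (same i)

  maxBelow-same : ∀ k → maxBelow ⟦ k ⟧ (word σ) ≡ maxBelow ⟦ k ⟧ (word τ)
  maxBelow-same k = trans (maxBelow-word σ k)
    (trans (cong (λ t → maxLeftOfGap t (collapse ⟦ k ⟧ down (word σ))) (tot-same k))
      (trans (maxLeftOfGap-same k (tot τ k)) (sym (maxBelow-word τ k))))

  words-agree : Agree (word σ) (word τ)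
  words-agree v∈ with ∈-tabulate⁻ {f = λ i → ⟦ σ ⟨$⟩ʳ i ⟧} v∈
  ... | i , refl = subst (_∈ word τ) (cong ⟦_⟧ (inverseʳ τ)) (∈-tabulate⁺ {f = λ i → ⟦ τ ⟨$⟩ʳ i ⟧} (τ ⟨$⟩ˡ (σ ⟨$⟩ʳ i)))
                 , maxBelow-same (σ ⟨$⟩ʳ i)

BST-same : ∀ {m} (σ τ : Permutation′ (suc m)) → SameLeft σ τ → BST σ ≡ BST τ
BST-same {m} σ τ same = bst-agree (words-agree σ τ same)
  (words-agree τ σ (λ i → sym (proj₁ (same i)) , sym (proj₂ (same i)))) (suc m) 1 (suc m) ≤-refl

-- Left steps and weights preserved by `Ψ`.

swap-pairs-swaps : ∀ a b D → swap-pairs (a ∷ b ∷ D) ≡ b ∷ a ∷ swap-pairs D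
swap-pairs-swaps up   up   D = refl
swap-pairs-swaps up   down D = refl
swap-pairs-swaps down up   D = refl
swap-pairs-swaps down down D = refl

module _ {n n′ : ℕ} (τ : Permutation′ n) (σ : Permutation′ n′) (e : ℕ) where

  -- Without its first step, the path of `σ` pairs the left step of a value with the right step of
  -- the next one. The exchange puts that left step second, where the path of `τ` has a left step
  -- too. The left step of the last value stays unpaired.
  swap-pairs-left-steps : ∀ {m} (g : Fin m → Fin n) (f : Fin (suc m) → Fin n′) →
    concatMap (two-steps 0 τ) (tabulate g) ++ down ∷ [] ≡
      swap-pairs (left-step e σ (f Fin.zero) ∷ concatMap (two-steps e σ) (tabulate (f ∘ Fin.suc))) →
    ∀ i → left-step e σ (f (inject₁ i)) ≡ left-step 0 τ (g i)
  swap-pairs-left-steps {suc m} g f q i with trans q (swap-pairs-swaps (left-step e σ (f Fin.zero)) _ _)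
  swap-pairs-left-steps {suc m} g f q Fin.zero    | q′ = sym (∷-injectiveˡ (∷-injectiveʳ q′))
  swap-pairs-left-steps {suc m} g f q (Fin.suc i) | q′ =
    swap-pairs-left-steps (g ∘ Fin.suc) (f ∘ Fin.suc) (∷-injectiveʳ (∷-injectiveʳ q′)) i

tabulate-∷ʳ-injective : ∀ {A : Set} {m} (g : Fin m → A) (f : Fin (suc m) → A) {x} →
  Vec.tabulate g Vec.∷ʳ x ≡ Vec.tabulate f → ∀ i → f (inject₁ i) ≡ g i
tabulate-∷ʳ-injective g f e Fin.zero    = sym (Vec.∷-injectiveˡ e)
tabulate-∷ʳ-injective g f e (Fin.suc i) = tabulate-∷ʳ-injective (g ∘ Fin.suc) (f ∘ Fin.suc) (Vec.∷-injectiveʳ e) i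

theorem6p10 : ∀ (m : ℕ) (σ : Permutation′ (suc m)) → BST σ ≡ BST (Ψ σ)
theorem6p10 m σ = BST-same σ (Ψ σ) λ i →
    -- `SameLeft` takes 0 as the letter after the last, whereas `FV-path` takes n + 1, here
    -- `suc (suc m)`.
    trans (sym (left-step-indep σ (suc (suc m)) (inject₁ i)))
      (swap-pairs-left-steps (Ψ σ) σ (suc (suc m)) inject₁ id (∷-injectiveʳ (proj₁ data-Ψ)) i)
  , tabulate-∷ʳ-injective (tot (Ψ σ) ∘ inject₁) (tot σ) (proj₂ data-Ψ) i
  -- Applying `ψ⁰FV` to `Ψ σ` returns the path and the weight of `ψ (ψFV σ)`.
  where data-Ψ = ψ⁰FV-ψ⁰FV⁻¹ (ψ (ψFV σ))
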